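{- Let $\varepsilon>0$ be fixed, and let $(\mathfrak{X}^{(t)})_{t\ge1}$ be a sequence of primitive coherent configurations whose numbers of vertices $n=n(t)$ tend to infinity, such that $\rho/n^{2/3}\to 0$, and such that in each $\mathfrak{X}^{(t)}$ every nondominant color $i$ satisfies $\lambda_i\ge \varepsilon n^{1/2}$. Then for all sufficiently large $t$ there is a clique geometry $\mathcal{G}^{(t)}$ on $\mathfrak{X}^{(t)}$, and these clique geometries are asymptotically uniform.
   Context: A primitive coherent configuration (PCC) on a finite set $V$, $|V|=n$, is a map $c:V\times V\to\{0,\ldots,r-1\}$ such that: color $0$ is exactly the set of diagonal pairs; for every color $i$ there is $i^*$ with $c(u,v)=i$ iff $c(v,u)=i^*$; for all $i,j,k$ there is $p^i_{jk}$ such that whenever $c(u,v)=i$, exactly $p^i_{jk}$ vertices $w$ satisfy $c(u,w)=j$, $c(w,v)=k$; and each digraph $(V,\{(u,v):c(u,v)=i\})$, $i\ne0$, is strongly connected. $\mathfrak{X}_i(u)=\{v:c(u,v)=i\}$, $n_i=|\mathfrak{X}_i(u)|$. Colors are indexed so that $n_1=\max_i n_i$, and $\rho=n-n_1-1$. A color $i\ne0$ is nondominant if $n_i<n/2$. $G(\mathfrak{X})$ is the (undirected) graph on $V$ in which distinct $u,v$ are adjacent iff $c(u,v)$ is nondominant; $N(v)$ is the neighborhood of $v$ in $G(\mathfrak{X})$. For a nondominant color $i$, $\lambda_i=|\mathfrak{X}_i(u)\cap N(v)|$ for any $u,v$ with $c(u,v)=i$ (well defined by coherence). A clique geometry on $\mathfrak{X}$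 is a collection $\mathcal{G}$ of maximal cliques of $G(\mathfrak{X})$ such that every pair of adjacent vertices of $G(\mathfrak{X})$ lies in exactly one clique of $\mathcal{G}$. A sequence of clique geometries $\mathcal{G}^{(t)}$ on $\mathfrak{X}^{(t)}$ is asymptotically uniform if the maximum of $\left||C\cap\mathfrak{X}_i(u)|/\lambda_i - 1\right|$ over all $C\in\mathcal{G}^{(t)}$, $u\in C$ and nondominant colors $i$ with $C\cap \mathfrak{X}_i(u)\ne\emptyset$ tends to $0$ as $t\to\infty$. -}

module Defs where

open import Data.Nat using (ℕ; zero; suc; _+_; _*_; _∸_; _^_; _≤_; _<_; _<?_; _⊔_; ∣_-_∣)
open import Data.Fin using (Fin; zero; suc)
open import Data.Fin.Properties using (all?) renaming (_≟_ to _≟ᶠ_)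
open import Data.Fin.Subset using (Subset; _∈_; _⊆_; _∩_; ∣_∣)
open import Data.Vec using (tabulate)
open import Data.List using (List; foldr; map; allFin)
open import Data.List.Membership.Propositional renaming (_∈_ to _∈ˡ_)
open import Data.Product using (Σ; ∃; _×_; _,_)
open import Data.Sum using (_⊎_)
open import Relation.Nullary using (¬_; Dec; does; _×-dec_; ¬?)

open import Relation.Binary.PropositionalEquality using (_≡_)
open import Relation.Binary.Construct.Closure.ReflexiveTransitive using (Star)
open import Function.Bundles using (_⇔_)

Coloring : ℕ → ℕ → Set
Coloring n r = Fin n → Fin n → Fin (suc r)

module _ {n r : ℕ} (c : Coloring n r) where

  X : Fin (suc r) → Fin n → Subset n
  X i u = tabulate (λ v → does (c u v ≟ᶠ i))

  Xin : Fin (suc r) → Fin n → Subset n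
  Xin k v = tabulate (λ w → does (c w v ≟ᶠ k))

  deg : Fin (suc r) → Fin n → ℕ
  deg i u = ∣ X i u ∣

  record IsPCC : Set where
    field
      diag      : ∀ u v → (c u v ≡ zero) ⇔ (u ≡ v)
      converse  : ∀ i → ∃ λ i* → ∀ u v → (c u v ≡ i) ⇔ (c v u ≡ i*)
      coherent  : ∀ i j k → ∃ λ p → ∀ u v → c u v ≡ i → ∣ X j u ∩ Xin k v ∣ ≡ p
      strongConn : ∀ i → ¬ (i ≡ zero) → ∀ u v → Star (λ a b → c a b ≡ i) u v

  Nondominant : Fin (suc r) → Set
  Nondominant i = ¬ (i ≡ zero) × (∀ u → 2 * deg i u < n)

  nondominant? : ∀ i → Dec (Nondominant i)
  nondominant? i = ¬? (i ≟ᶠ zero) ×-dec all? (λ u → 2 * deg i u <? n)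

  Adj : Fin n → Fin n → Set
  Adj u v = ¬ (u ≡ v) × Nondominant (c u v)

  adj? : ∀ u v → Dec (Adj u v)
  adj? u v = ¬? (u ≟ᶠ v) ×-dec nondominant? (c u v)

  N : Fin n → Subset n
  N v = tabulate (λ w → does (adj? v w))

  -- λ_{c(u,v)} computed at the pair (u,v): |𝔛_{c(u,v)}(u) ∩ N(v)|
  lam : Fin n → Fin n → ℕ
  lam u v = ∣ X (c u v) u ∩ N v ∣

  -- n_1 = max_i n_i  (max over all colors and vertices; n_i is vertex independent)
  n₁ : ℕ
  n₁ = foldr _⊔_ 0 (map (λ i → foldr _⊔_ 0 (map (deg i) (allFin n))) (allFin (suc r)))

  ρ : ℕ
  ρ = n ∸ n₁ ∸ 1

  IsClique : Subset n → Set
  IsClique C = ∀ u v → u ∈ C → v ∈ C → ¬ (u ≡ v) → Adj u v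

  IsMaximalClique : Subset n → Set
  IsMaximalClique C = IsClique C × (∀ D → IsClique D → C ⊆ D → D ⊆ C)

  IsCliqueGeometry : List (Subset n) → Set
  IsCliqueGeometry G =
    (∀ C → C ∈ˡ G → IsMaximalClique C) ×
    (∀ u v → Adj u v →
       (∃ λ C → C ∈ˡ G × u ∈ C × v ∈ C) ×
       (∀ C D → C ∈ˡ G → D ∈ˡ G → u ∈ C → v ∈ C → u ∈ D → v ∈ D → C ≡ D))

record PCC : Set where
  field
    n : ℕ
    r : ℕ
    c : Coloring n r
    isPCC : IsPCC c

-- every nondominant color i satisfies λ_i ≥ ε n^{1/2}, with ε = 1/(k+1):
-- equivalently n ≤ (k+1)^2 λ_i^2
LambdaBound : ℕ → PCC → Set
LambdaBound k 𝔛 = ∀ i → Nondominant c i → ∀ u v → c u v ≡ i →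
                  n ≤ (suc k ^ 2) * (lam c u v ^ 2)
  where open PCC 𝔛

-- ||C ∩ 𝔛_i(u)|/λ_i - 1| ≤ 1/(m+1) for all C ∈ G, u ∈ C, nondominant i
-- with C ∩ 𝔛_i(u) ≠ ∅ (witnessed by v ∈ C with c(u,v) = i)
UniformWithin : ℕ → (𝔛 : PCC) → List (Subset (PCC.n 𝔛)) → Set
UniformWithin m 𝔛 G = ∀ C → C ∈ˡ G → ∀ u v → u ∈ C → v ∈ C → Nondominant c (c u v) →
                      suc m * ∣ ∣ C ∩ X c (c u v) u ∣ - lam c u v ∣ ≤ lam c u v
  where open PCC 𝔛

{-# OPTIONS --safe #-}
module Submission where

-- Two vertices joined by the dominant color have μ = O(ρ² / n) common neighbors, so with
-- Λ = min λᵢ of order n^{1/2} one has ρ μ = o(Λ²).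
--
-- Fix a vertex u and a nondominant color i. The graph induced on 𝔛ᵢ(u) is λᵢ-regular, and a
-- maximal independent set in it can be improved until the private neighborhoods of its members
-- are cliques of size ~ λᵢ; every vertex is then complete to one of them. This partitions 𝔛ᵢ(u)
-- into cliques ("parts") of size ~ λᵢ, and a vertex outside a part is either complete to it or has
-- at most μ neighbors in it.
--
-- Counting edges between 𝔛ᵢ(u) and 𝔛ⱼ(u), where coherence makes the degrees constant, shows that
-- if one vertex w of 𝔛ⱼ(u) is complete to a part of 𝔛ᵢ(u), then so is the whole part of w.
-- Hence parts of different colors glue into cliques through u, and a large maximal clique Q
-- through u meets some part at u in more than μ vertices, so that Q is the glued clique of that
-- part. Thus an adjacent pair (u , w) in Q determines Q, and Q ∩ 𝔛ⱼ(u) is the part of w.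

open import Defs
open import Data.Bool using (true; false; if_then_else_)
open import Data.Fin using (Fin; zero; suc)
open import Data.Fin.Properties using (any?; all?) renaming (_≟_ to _≟ᶠ_)
open import Data.Fin.Subset using (Subset; _∈_; _∉_; _⊆_; _∩_; _∪_; ∁; ⁅_⁆; ∣_∣; ⊤) renaming (⊥ to ∅)
open import Data.Fin.Subset.Properties
open import Data.List using (List; []; _∷_; foldr; map; filter; cartesianProduct; allFin)
open import Data.List.Membership.Propositional using () renaming (_∈_ to _∈ˡ_)
open import Data.List.Membership.Propositional.Properties
open import Data.Nat using (ℕ; zero; suc; _+_; _*_; _∸_; _^_; _⊔_; _≤_; _<_; z≤n; s≤s; _≤?_; >-nonZero; ∣_-_∣)
open import Data.Nat.DivMod using (_/_; _%_; m≡m%n+[m/n]*n; m%n<n)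
open import Data.Nat.Properties hiding (_≟_)
open import Data.Nat.Tactic.RingSolver using (solve-∀)
open import Data.Product using (Σ; ∃; _×_; _,_; proj₁; proj₂)
open import Data.Sum using (_⊎_; inj₁; inj₂; [_,_])
open import Data.Vec using ([]; _∷_; tabulate; lookup; here; there)
open import Data.Vec.Properties using (lookup∘tabulate; lookup⇒[]=; []=⇒lookup)
open import Function using (_∘_; id)
open import Function.Bundles using (_⇔_; Equivalence)
open import Relation.Binary.PropositionalEquality using (_≡_; _≢_; refl; sym; trans; cong; cong₂; subst)
open import Relation.Nullary using (¬_; Dec; yes; no; does; contradiction; ¬?; _×-dec_; _⊎-dec_; _→-dec_)
open import Relation.Nullary.Decidable using (dec-true; decidable-stable)
open import Relation.Unary using (Decidable)

-- Counting in finite sets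

private
  variable
    m ℓ : ℕ

⟪_⟫ : {P : Fin ℓ → Set} → Decidable P → Subset ℓ
⟪ P? ⟫ = tabulate (λ x → does (P? x))

∈⟪⟫⁺ : {P : Fin ℓ → Set} (P? : Decidable P) {x : Fin ℓ} → P x → x ∈ ⟪ P? ⟫
∈⟪⟫⁺ P? {x} px = lookup⇒[]= x _ (trans (lookup∘tabulate _ x) (dec-true (P? x) px))

∈⟪⟫⁻ : {P : Fin ℓ → Set} (P? : Decidable P) {x : Fin ℓ} → x ∈ ⟪ P? ⟫ → P x
∈⟪⟫⁻ P? {x} x∈ with P? x | trans (sym (lookup∘tabulate (does ∘ P?) x)) ([]=⇒lookup x∈)
... | yes px | _ = px
... | no _ | ()

∑ : Subset ℓ → (Fin ℓ → ℕ) → ℕ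
∑ [] f = 0
∑ (true ∷ S) f = f zero + ∑ S (f ∘ suc)
∑ (false ∷ S) f = ∑ S (f ∘ suc)

∑-mono : (S : Subset ℓ) {f g : Fin ℓ → ℕ} → (∀ {x} → x ∈ S → f x ≤ g x) → ∑ S f ≤ ∑ S g
∑-mono [] h = z≤n
∑-mono (true ∷ S) h = +-mono-≤ (h here) (∑-mono S (h ∘ there))
∑-mono (false ∷ S) h = ∑-mono S (h ∘ there)

∑-cong : (S : Subset ℓ) {f g : Fin ℓ → ℕ} → (∀ {x} → x ∈ S → f x ≡ g x) → ∑ S f ≡ ∑ S g
∑-cong S h = ≤-antisym (∑-mono S (≤-reflexive ∘ h)) (∑-mono S (≤-reflexive ∘ sym ∘ h))

∑-const : (S : Subset ℓ) (b : ℕ) → ∑ S (λ _ → b) ≡ ∣ S ∣ * b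
∑-const [] b = refl
∑-const (true ∷ S) b = cong (b +_) (∑-const S b)
∑-const (false ∷ S) b = ∑-const S b

∑-+ : (S : Subset ℓ) (f g : Fin ℓ → ℕ) → ∑ S (λ x → f x + g x) ≡ ∑ S f + ∑ S g
∑-+ [] f g = refl
∑-+ (true ∷ S) f g rewrite ∑-+ S (f ∘ suc) (g ∘ suc) =
  swap-middle (f zero) (g zero) (∑ S (f ∘ suc)) (∑ S (g ∘ suc))
  where
  swap-middle : ∀ a b c d → (a + b) + (c + d) ≡ (a + c) + (b + d)
  swap-middle = solve-∀
∑-+ (false ∷ S) f g = ∑-+ S (f ∘ suc) (g ∘ suc)

∑-*ˡ : (S : Subset ℓ) (b : ℕ) (f : Fin ℓ → ℕ) → ∑ S (λ x → b * f x) ≡ b * ∑ S f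
∑-*ˡ [] b f = sym (*-zeroʳ b)
∑-*ˡ (true ∷ S) b f rewrite ∑-*ˡ S b (f ∘ suc) = sym (*-distribˡ-+ b (f zero) _)
∑-*ˡ (false ∷ S) b f = ∑-*ˡ S b (f ∘ suc)

∑-comm : (S : Subset m) (T : Subset ℓ) (k : Fin m → Fin ℓ → ℕ) →
  ∑ S (λ x → ∑ T (k x)) ≡ ∑ T (λ y → ∑ S (λ x → k x y))
∑-comm [] T k = sym (trans (∑-const T 0) (*-zeroʳ ∣ T ∣))
∑-comm (true ∷ S) T k = trans (cong (∑ T (k zero) +_) (∑-comm S T (k ∘ suc)))
  (sym (∑-+ T (k zero) (λ y → ∑ S (λ x → k (suc x) y))))
∑-comm (false ∷ S) T k = ∑-comm S T (k ∘ suc)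

-- Moving the condition into the summand frees the range from `F`, so that two sums can be exchanged
-- even when the inner range depends on the outer variable.
∑-∩ : (T F : Subset ℓ) (g : Fin ℓ → ℕ) →
  ∑ (T ∩ F) g ≡ ∑ T (λ y → if lookup F y then g y else 0)
∑-∩ [] [] g = refl
∑-∩ (true ∷ T) (true ∷ F) g = cong (g zero +_) (∑-∩ T F (g ∘ suc))
∑-∩ (true ∷ T) (false ∷ F) g = ∑-∩ T F (g ∘ suc)
∑-∩ (false ∷ T) (_ ∷ F) g = ∑-∩ T F (g ∘ suc)

∣∣-∑ : (S : Subset ℓ) → ∣ S ∣ ≡ ∑ S (λ _ → 1)
∣∣-∑ S = sym (trans (∑-const S 1) (*-identityʳ ∣ S ∣))

-- Double counting with weights; in `matching` the weights let a sum over parts be taken over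
-- vertices.
∑-swap-≤ : (S : Subset m) (T : Subset ℓ) (F : Fin m → Subset ℓ) (G : Fin ℓ → Subset m)
  (k : Fin m → Fin ℓ → ℕ) →
  (∀ {x y} → x ∈ S → y ∈ T → y ∈ F x → x ∈ G y) →
  ∑ S (λ x → ∑ (T ∩ F x) (k x)) ≤ ∑ T (λ y → ∑ (S ∩ G y) (λ x → k x y))
∑-swap-≤ S T F G k F⇒G = begin
  ∑ S (λ x → ∑ (T ∩ F x) (k x))
    ≡⟨ ∑-cong S (λ {x} _ → ∑-∩ T (F x) (k x)) ⟩
  ∑ S (λ x → ∑ T (λ y → if lookup (F x) y then k x y else 0))
    ≤⟨ ∑-mono S (λ x∈S → ∑-mono T (λ y∈T → entry x∈S y∈T)) ⟩
  ∑ S (λ x → ∑ T (λ y → if lookup (G y) x then k x y else 0))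
    ≡⟨ ∑-comm S T _ ⟩
  ∑ T (λ y → ∑ S (λ x → if lookup (G y) x then k x y else 0))
    ≡⟨ ∑-cong T (λ {y} _ → ∑-∩ S (G y) (λ x → k x y)) ⟨
  ∑ T (λ y → ∑ (S ∩ G y) (λ x → k x y)) ∎
  where
  open ≤-Reasoning
  entry : ∀ {x y} → x ∈ S → y ∈ T →
    (if lookup (F x) y then k x y else 0) ≤ (if lookup (G y) x then k x y else 0)
  entry {x} {y} x∈S y∈T with lookup (F x) y in eq
  ... | false = z≤n
  ... | true rewrite []=⇒lookup (F⇒G x∈S y∈T (lookup⇒[]= y (F x) eq)) = ≤-refl

double-count-≤ : (S : Subset m) (T : Subset ℓ) (F : Fin m → Subset ℓ) (G : Fin ℓ → Subset m) →
  (∀ {x y} → x ∈ S → y ∈ T → y ∈ F x → x ∈ G y) →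
  ∑ S (λ x → ∣ T ∩ F x ∣) ≤ ∑ T (λ y → ∣ S ∩ G y ∣)
double-count-≤ S T F G F⇒G = begin
  ∑ S (λ x → ∣ T ∩ F x ∣)              ≡⟨ ∑-cong S (λ {x} _ → ∣∣-∑ (T ∩ F x)) ⟩
  ∑ S (λ x → ∑ (T ∩ F x) (λ _ → 1))    ≤⟨ ∑-swap-≤ S T F G (λ _ _ → 1) F⇒G ⟩
  ∑ T (λ y → ∑ (S ∩ G y) (λ _ → 1))    ≡⟨ ∑-cong T (λ {y} _ → ∣∣-∑ (S ∩ G y)) ⟨
  ∑ T (λ y → ∣ S ∩ G y ∣)              ∎
  where open ≤-Reasoning

double-count : (S : Subset m) (T : Subset ℓ) (F : Fin m → Subset ℓ) (G : Fin ℓ → Subset m) →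
  (∀ {x y} → x ∈ S → y ∈ T → y ∈ F x → x ∈ G y) →
  (∀ {x y} → x ∈ S → y ∈ T → x ∈ G y → y ∈ F x) →
  ∑ S (λ x → ∣ T ∩ F x ∣) ≡ ∑ T (λ y → ∣ S ∩ G y ∣)
double-count S T F G F⇒G G⇒F = ≤-antisym (double-count-≤ S T F G F⇒G)
  (double-count-≤ T S G F (λ y∈T x∈S → G⇒F x∈S y∈T))

∣∣-split : (A B : Subset ℓ) → ∣ A ∣ ≡ ∣ A ∩ B ∣ + ∣ A ∩ ∁ B ∣
∣∣-split [] [] = refl
∣∣-split (true ∷ A) (true ∷ B) = cong suc (∣∣-split A B)
∣∣-split (true ∷ A) (false ∷ B) = trans (cong suc (∣∣-split A B)) (sym (+-suc _ _))
∣∣-split (false ∷ A) (_ ∷ B) = ∣∣-split A B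

∣∣-cover : {A B C : Subset ℓ} → (∀ {x} → x ∈ A → x ∈ B ⊎ x ∈ C) → ∣ A ∣ ≤ ∣ B ∣ + ∣ C ∣
∣∣-cover {A = A} {B} {C} h = subst (_≤ ∣ B ∣ + ∣ C ∣) (sym (∣∣-split A B))
  (+-mono-≤ (∣p∩q∣≤∣q∣ A B) (p⊆q⇒∣p∣≤∣q∣ rest))
  where
  rest : A ∩ ∁ B ⊆ C
  rest x∈ with x∈p∩q⁻ A (∁ B) x∈
  ... | x∈A , x∈∁B with h x∈A
  ... | inj₁ x∈B = contradiction x∈B (x∈∁p⇒x∉p x∈∁B)
  ... | inj₂ x∈C = x∈C

∣∣-disjoint : {A B C : Subset ℓ} → B ⊆ A → C ⊆ A → (∀ {x} → x ∈ B → x ∉ C) →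
  ∣ B ∣ + ∣ C ∣ ≤ ∣ A ∣
∣∣-disjoint {A = A} {B} {C} B⊆A C⊆A dis = subst (∣ B ∣ + ∣ C ∣ ≤_) (sym (∣∣-split A B))
  (+-mono-≤ (p⊆q⇒∣p∣≤∣q∣ (λ x∈B → x∈p∩q⁺ (B⊆A x∈B , x∈B)))
            (p⊆q⇒∣p∣≤∣q∣ (λ x∈C → x∈p∩q⁺ (C⊆A x∈C , x∉p⇒x∈∁p (λ x∈B → dis x∈B x∈C)))))

∣∣-incl-excl : {A B C : Subset ℓ} → B ⊆ A → C ⊆ A → ∣ B ∣ + ∣ C ∣ ≤ ∣ B ∩ C ∣ + ∣ A ∣
∣∣-incl-excl {A = A} {B} {C} B⊆A C⊆A = begin
  ∣ B ∣ + ∣ C ∣                          ≡⟨ cong (_+ ∣ C ∣) (∣∣-split B C) ⟩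
  (∣ B ∩ C ∣ + ∣ B ∩ ∁ C ∣) + ∣ C ∣      ≡⟨ +-assoc ∣ B ∩ C ∣ _ _ ⟩
  ∣ B ∩ C ∣ + (∣ B ∩ ∁ C ∣ + ∣ C ∣)      ≤⟨ +-monoʳ-≤ ∣ B ∩ C ∣ (∣∣-disjoint
      (λ x∈ → B⊆A (proj₁ (x∈p∩q⁻ B (∁ C) x∈))) C⊆A
      (λ x∈ → x∈∁p⇒x∉p (proj₂ (x∈p∩q⁻ B (∁ C) x∈)))) ⟩
  ∣ B ∩ C ∣ + ∣ A ∣                      ∎
  where open ≤-Reasoning

∣∣-pos : {A : Subset ℓ} {x : Fin ℓ} → x ∈ A → 1 ≤ ∣ A ∣
∣∣-pos {A = true ∷ A} _ = s≤s z≤n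
∣∣-pos {A = false ∷ A} (there x∈) = ∣∣-pos x∈

∣∣≤1 : {A : Subset ℓ} → (∀ {x y} → x ∈ A → y ∈ A → x ≡ y) → ∣ A ∣ ≤ 1
∣∣≤1 {ℓ} {A = A} h with nonempty? A
... | yes (x , x∈A) = subst (∣ A ∣ ≤_) (∣⁅x⁆∣≡1 x)
  (p⊆q⇒∣p∣≤∣q∣ (λ y∈A → subst (_∈ ⁅ x ⁆) (h x∈A y∈A) (x∈⁅x⁆ x)))
... | no ¬x = subst (_≤ 1) (sym (trans (cong ∣_∣ (Empty-unique ¬x)) (∣⊥∣≡0 ℓ))) z≤n

-- Incidences between points of `A` outside `B` and indices `s` are counted in two ways: each such
-- point lies in some `F s`, and each `s` accounts for at most `b` of them.
∣∣-union-bound : {A B : Subset ℓ} {S : Subset m} (F : Fin m → Subset ℓ) {b : ℕ} →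
  (∀ {x} → x ∈ A → x ∈ B ⊎ ∃ λ s → s ∈ S × x ∈ F s) →
  (∀ {s} → s ∈ S → ∣ A ∩ F s ∣ ≤ b) → ∣ A ∣ ≤ ∣ B ∣ + ∣ S ∣ * b
∣∣-union-bound {A = A} {B} {S} F {b} cov small = ≤-trans (∣∣-cover {C = A ∩ ∁ B} split) (+-monoʳ-≤ ∣ B ∣ rest)
  where
  open ≤-Reasoning
  split : ∀ {x} → x ∈ A → x ∈ B ⊎ x ∈ A ∩ ∁ B
  split {x} x∈A with x ∈? B
  ... | yes x∈B = inj₁ x∈B
  ... | no x∉B = inj₂ (x∈p∩q⁺ (x∈A , x∉p⇒x∈∁p x∉B))
  G? : ∀ x → Decidable (λ s → x ∈ F s)
  G? x s = x ∈? F s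
  hit : ∀ {x} → x ∈ A ∩ ∁ B → 1 ≤ ∣ S ∩ ⟪ G? x ⟫ ∣
  hit {x} x∈ with x∈p∩q⁻ A (∁ B) x∈
  ... | x∈A , x∈∁B with cov x∈A
  ... | inj₁ x∈B = contradiction x∈B (x∈∁p⇒x∉p x∈∁B)
  ... | inj₂ (s , s∈S , x∈F) = ∣∣-pos (x∈p∩q⁺ (s∈S , ∈⟪⟫⁺ (G? x) x∈F))
  rest : ∣ A ∩ ∁ B ∣ ≤ ∣ S ∣ * b
  rest = begin
    ∣ A ∩ ∁ B ∣                              ≡⟨ ∣∣-∑ (A ∩ ∁ B) ⟩
    ∑ (A ∩ ∁ B) (λ _ → 1)                    ≤⟨ ∑-mono (A ∩ ∁ B) hit ⟩
    ∑ (A ∩ ∁ B) (λ x → ∣ S ∩ ⟪ G? x ⟫ ∣)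
      ≤⟨ double-count-≤ (A ∩ ∁ B) S (λ x → ⟪ G? x ⟫) F (λ {x} _ _ → ∈⟪⟫⁻ (G? x)) ⟩
    ∑ S (λ s → ∣ (A ∩ ∁ B) ∩ F s ∣)          ≤⟨ ∑-mono S (λ {s} s∈S → ≤-trans (p⊆q⇒∣p∣≤∣q∣ (shrink s)) (small s∈S)) ⟩
    ∑ S (λ _ → b)                            ≡⟨ ∑-const S b ⟩
    ∣ S ∣ * b                                ∎
    where
    shrink : ∀ s → (A ∩ ∁ B) ∩ F s ⊆ A ∩ F s
    shrink s x∈ with x∈p∩q⁻ (A ∩ ∁ B) (F s) x∈
    ... | x∈A∖B , x∈F = x∈p∩q⁺ (proj₁ (x∈p∩q⁻ A (∁ B) x∈A∖B) , x∈F)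

∣∣-remove : {S : Subset ℓ} {s : Fin ℓ} → s ∈ S → ∣ S ∣ ≡ suc ∣ S ∩ ∁ ⁅ s ⁆ ∣
∣∣-remove {S = S} {s} s∈S = trans (∣∣-split S ⁅ s ⁆) (cong (_+ ∣ S ∩ ∁ ⁅ s ⁆ ∣)
  (≤-antisym (subst (∣ S ∩ ⁅ s ⁆ ∣ ≤_) (∣⁅x⁆∣≡1 s) (∣p∩q∣≤∣q∣ S ⁅ s ⁆))
             (∣∣-pos (x∈p∩q⁺ (s∈S , x∈⁅x⁆ s)))))

∣∣-insert : {S : Subset ℓ} {x : Fin ℓ} → x ∉ S → ∣ S ∪ ⁅ x ⁆ ∣ ≡ suc ∣ S ∣
∣∣-insert {S = S} {x} x∉S = trans (∣∣-remove x∈) (cong suc (cong ∣_∣ (⊆-antisym drop keep)))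
  where
  x∈ : x ∈ S ∪ ⁅ x ⁆
  x∈ = x∈p∪q⁺ {p = S} (inj₂ (x∈⁅x⁆ x))
  drop : (S ∪ ⁅ x ⁆) ∩ ∁ ⁅ x ⁆ ⊆ S
  drop y∈ with x∈p∩q⁻ (S ∪ ⁅ x ⁆) (∁ ⁅ x ⁆) y∈
  ... | y∈∪ , y∈∁ with x∈p∪q⁻ S ⁅ x ⁆ y∈∪
  ... | inj₁ y∈S = y∈S
  ... | inj₂ y∈x = contradiction y∈x (x∈∁p⇒x∉p y∈∁)
  keep : S ⊆ (S ∪ ⁅ x ⁆) ∩ ∁ ⁅ x ⁆
  keep y∈S = x∈p∩q⁺ (x∈p∪q⁺ (inj₁ y∈S) ,
    x∉p⇒x∈∁p (λ y∈x → x∉S (subst (_∈ S) (x∈⁅y⁆⇒x≡y x y∈x) y∈S)))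

∈-remove⁻ : (S : Subset ℓ) {s x : Fin ℓ} → x ∈ S ∩ ∁ ⁅ s ⁆ → x ∈ S × x ≢ s
∈-remove⁻ S {s} {x} x∈ with x∈p∩q⁻ S (∁ ⁅ s ⁆) x∈
... | x∈S , x∈∁ = x∈S , λ x≡s → x∈∁p⇒x∉p x∈∁ (subst (_∈ ⁅ s ⁆) (sym x≡s) (x∈⁅x⁆ s))

∈-remove⁺ : {S : Subset ℓ} {s x : Fin ℓ} → x ∈ S → x ≢ s → x ∈ S ∩ ∁ ⁅ s ⁆
∈-remove⁺ {s = s} x∈S x≢s = x∈p∩q⁺ (x∈S , x∉p⇒x∈∁p (x≢s ∘ x∈⁅y⁆⇒x≡y s))

∣∣-fibres : ∀ {m n} (f : Fin n → Fin m) (T : Subset n) (K : Subset m) → (∀ {x} → x ∈ T → f x ∈ K) →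
  ∣ T ∣ ≡ ∑ K (λ k → ∣ T ∩ ⟪ (λ x → f x ≟ᶠ k) ⟫ ∣)
∣∣-fibres f T K into = begin-equality
  ∣ T ∣                                          ≡⟨ ∣∣-∑ T ⟩
  ∑ T (λ _ → 1)                                  ≡⟨ ∑-cong T (λ {x} x∈ → one x (into x∈)) ⟩
  ∑ T (λ x → ∣ K ∩ ⁅ f x ⁆ ∣)                    ≡⟨ double-count T K (λ x → ⁅ f x ⁆) (λ k → ⟪ (λ x → f x ≟ᶠ k) ⟫)
      (λ {x} {k} _ _ k∈ → ∈⟪⟫⁺ (λ x → f x ≟ᶠ k) (sym (x∈⁅y⁆⇒x≡y (f x) k∈)))
      (λ {x} {k} _ _ x∈ → subst (λ y → k ∈ ⁅ y ⁆) (sym (∈⟪⟫⁻ (λ x → f x ≟ᶠ k) x∈)) (x∈⁅x⁆ k)) ⟩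
  ∑ K (λ k → ∣ T ∩ ⟪ (λ x → f x ≟ᶠ k) ⟫ ∣)       ∎
  where
  open ≤-Reasoning
  one : ∀ x → f x ∈ K → 1 ≡ ∣ K ∩ ⁅ f x ⁆ ∣
  one x fx∈ = ≤-antisym (∣∣-pos (x∈p∩q⁺ (fx∈ , x∈⁅x⁆ (f x))))
    (subst (∣ K ∩ ⁅ f x ⁆ ∣ ≤_) (∣⁅x⁆∣≡1 (f x)) (∣p∩q∣≤∣q∣ K ⁅ f x ⁆))

-- Maxima, least elements and rounding

foldr-⊔-attained : {A : Set} (f : A → ℕ) (xs : List A) → 0 < foldr _⊔_ 0 (map f xs) →
  ∃ λ x → f x ≡ foldr _⊔_ 0 (map f xs)
foldr-⊔-attained f (x ∷ xs) pos with ≤-total (foldr _⊔_ 0 (map f xs)) (f x)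
... | inj₁ rest≤ = x , sym (m≥n⇒m⊔n≡m rest≤)
... | inj₂ ≤rest = let y , eq = foldr-⊔-attained f xs (subst (0 <_) (m≤n⇒m⊔n≡n ≤rest) pos) in
  y , trans eq (sym (m≤n⇒m⊔n≡n ≤rest))

least : {P : ℕ → Set} → Decidable P → ∀ b → P b → ∃ λ l → P l × (∀ {x} → P x → l ≤ x)
least P? b Pb with P? 0
... | yes P0 = 0 , P0 , λ _ → z≤n
least P? zero Pb | no ¬P0 = contradiction Pb ¬P0
least {P} P? (suc b) Pb | no ¬P0 with least (P? ∘ suc) b Pb
... | l , Pl , min = suc l , Pl , λ {x} → bound x
  where
  bound : ∀ x → P x → suc l ≤ x
  bound zero P0 = contradiction P0 ¬P0
  bound (suc x) Px = s≤s (min Px)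

-- The witness is `k / l` plus one, so the bound is strict and overshoots by at most one `l`.
multiple-above : ∀ k l → 1 ≤ l → ∃ λ t → k < t * l × t * l ≤ k + l
multiple-above k l 1≤l = suc q , above , below
  where
  instance _ = >-nonZero 1≤l
  q = k / l
  open ≤-Reasoning
  above : k < suc q * l
  above = begin-strict
    k                ≡⟨ m≡m%n+[m/n]*n k l ⟩
    k % l + q * l    <⟨ +-monoˡ-< (q * l) (m%n<n k l) ⟩
    l + q * l        ∎
  below : suc q * l ≤ k + l
  below = begin
    l + q * l            ≤⟨ +-monoʳ-≤ l (m≤n+m (q * l) (k % l)) ⟩
    l + (k % l + q * l)  ≡⟨ cong (l +_) (m≡m%n+[m/n]*n k l) ⟨
    l + k                ≡⟨ +-comm l k ⟩
    k + l                ∎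

distance-≤ : ∀ {a b e} → a ≤ b + e → b ≤ a + e → ∣ a - b ∣ ≤ e
distance-≤ {a} {b} {e} a≤ b≤ with ≤-total a b
... | inj₁ a≤b = subst (_≤ e) (sym (m≤n⇒∣m-n∣≡n∸m a≤b)) (m≤n+o⇒m∸n≤o b a b≤)
... | inj₂ b≤a = subst (_≤ e) (sym (m≤n⇒∣n-m∣≡n∸m b≤a)) (m≤n+o⇒m∸n≤o a b a≤)

-- Cliques in regular graphs with few common neighbors

module Graph {n : ℕ} (_~_ : Fin n → Fin n → Set) (_~?_ : ∀ x y → Dec (x ~ y))
  (~-sym : ∀ {x y} → x ~ y → y ~ x) where

  nb : Fin n → Subset n
  nb x = ⟪ x ~?_ ⟫

  -- The reflexive closure of adjacency spares cliques and completeness a side condition on equal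
  -- vertices.
  Near : Fin n → Fin n → Set
  Near x y = x ≡ y ⊎ x ~ y

  near? : ∀ x y → Dec (Near x y)
  near? x y = (x ≟ᶠ y) ⊎-dec (x ~? y)

  near-sym : ∀ {x y} → Near x y → Near y x
  near-sym (inj₁ x≡y) = inj₁ (sym x≡y)
  near-sym (inj₂ x~y) = inj₂ (~-sym x~y)

  Clique : Subset n → Set
  Clique S = ∀ {x y} → x ∈ S → y ∈ S → Near x y

  Complete : Fin n → Subset n → Set
  Complete x S = ∀ {y} → y ∈ S → Near x y

  complete⇒⊆nb : ∀ {x S} → Complete x S → x ∉ S → S ⊆ nb x
  complete⇒⊆nb {x} {S} xS x∉S y∈S =
    [ (λ x≡y → contradiction (subst (_∈ S) (sym x≡y) y∈S) x∉S) , ∈⟪⟫⁺ (x ~?_) ] (xS y∈S)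

  module Sparse (ν : ℕ) (sparse : ∀ x y → ¬ Near x y → ∣ nb x ∩ nb y ∣ < ν) where

    -- Otherwise `A` would consist of common neighbors of `x` and `y`. Neither of them lies in `A`
    -- then, because the other one is near all of `A`.
    near-of-common : ∀ {x y A} → Complete x A → Complete y A → ν ≤ ∣ A ∣ → Near x y
    near-of-common {x} {y} {A} xA yA ν≤A = decidable-stable (near? x y) λ ¬xy →
      <⇒≱ (sparse x y ¬xy) (≤-trans ν≤A (p⊆q⇒∣p∣≤∣q∣ λ z∈A → x∈p∩q⁺ (nbx ¬xy z∈A , nby ¬xy z∈A)))
      where
      nbx : ¬ Near x y → ∀ {z} → z ∈ A → z ∈ nb x
      nbx ¬xy z∈A with xA z∈A
      ... | inj₁ refl = contradiction (near-sym (yA z∈A)) ¬xy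
      ... | inj₂ x~z = ∈⟪⟫⁺ (x ~?_) x~z
      nby : ¬ Near x y → ∀ {z} → z ∈ A → z ∈ nb y
      nby ¬xy z∈A with yA z∈A
      ... | inj₁ refl = contradiction (xA z∈A) ¬xy
      ... | inj₂ y~z = ∈⟪⟫⁺ (y ~?_) y~z

    few-nbs : ∀ {w z A} → Complete z A → ¬ Near w z → ∣ nb w ∩ A ∣ < ν
    few-nbs {w} {z} {A} zA ¬wz = ≤-<-trans (p⊆q⇒∣p∣≤∣q∣ sub) (sparse w z ¬wz)
      where
      sub : nb w ∩ A ⊆ nb w ∩ nb z
      sub {y} y∈ with x∈p∩q⁻ (nb w) A y∈
      ... | y∈nb , y∈A with zA y∈A
      ... | inj₁ refl = contradiction (inj₂ (∈⟪⟫⁻ (w ~?_) y∈nb)) ¬wz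
      ... | inj₂ z~y = x∈p∩q⁺ (y∈nb , ∈⟪⟫⁺ (z ~?_) z~y)

    -- A vertex `z` of the clique that is not near `w` would share with `w` all of `nb w ∩ A`.
    few-or-complete : ∀ {w A} → Clique A → ν ≤ ∣ nb w ∩ A ∣ → Complete w A
    few-or-complete {w} {A} cl ν≤ {z} z∈A = decidable-stable (near? w z) λ ¬wz →
      <⇒≱ (few-nbs (λ y∈A → cl z∈A y∈A) ¬wz) ν≤

    -- `e` is the additive error in the size. The successor in `upper` accounts for `v` itself,
    -- besides its neighbors in `H`.
    record IsLocalClique (H : Subset n) (λᵢ e : ℕ) (v : Fin n) (C : Subset n) : Set where
      field
        ⊆H : C ⊆ H
        ∋v : v ∈ C
        clique : Clique C
        few : ∀ {w} → w ∈ H → w ∉ C → ∣ nb w ∩ C ∣ < ν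
        lower : λᵢ ≤ ∣ C ∣ + e
        upper : ∣ C ∣ ≤ suc λᵢ

    -- By `t-small` the overlaps of `t` neighborhoods are negligible against `λᵢ`; by `t-large`
    -- there is then no room in `H` for `t` independent vertices.
    module Metsch (H : Subset n) (λᵢ t : ℕ) (regular : ∀ {x} → x ∈ H → ∣ H ∩ nb x ∣ ≡ λᵢ)
      (t-large : 2 * ∣ H ∣ < t * λᵢ) (t-small : 8 * (t * ν) ≤ λᵢ) where

      Indep : Subset n → Set
      Indep S = ∀ {x y} → x ∈ S → y ∈ S → Near x y → x ≡ y

      IsPrivate : Subset n → Fin n → Fin n → Set
      IsPrivate S s x = Near x s × (∀ s′ → s′ ∈ S → Near x s′ → s′ ≡ s)

      isPrivate? : ∀ S s → Decidable (IsPrivate S s)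
      isPrivate? S s x = near? x s ×-dec
        all? (λ s′ → (s′ ∈? S) →-dec (near? x s′ →-dec (s′ ≟ᶠ s)))

      privateNbs : Subset n → Fin n → Subset n
      privateNbs S s = H ∩ ⟪ isPrivate? S s ⟫

      ∈private⁻ : ∀ S s {x} → x ∈ privateNbs S s → x ∈ H × IsPrivate S s x
      ∈private⁻ S s x∈ with x∈p∩q⁻ H ⟪ isPrivate? S s ⟫ x∈
      ... | x∈H , x∈P = x∈H , ∈⟪⟫⁻ (isPrivate? S s) x∈P

      -- Of the `λᵢ` neighbors of `s`, each other member of `S` spoils fewer than `ν`, since it is
      -- not adjacent to `s`.
      private-large : ∀ {S s} → S ⊆ H → Indep S → ∣ S ∣ ≤ t → s ∈ S → λᵢ ≤ ∣ privateNbs S s ∣ + t * ν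
      private-large {S} {s} S⊆H ind S≤t s∈S = begin
        λᵢ                                                 ≡⟨ regular (S⊆H s∈S) ⟨
        ∣ H ∩ nb s ∣                                       ≤⟨ ∣∣-union-bound nb cover small ⟩
        ∣ privateNbs S s ∣ + ∣ S ∩ ∁ ⁅ s ⁆ ∣ * ν
          ≤⟨ +-monoʳ-≤ ∣ privateNbs S s ∣ (*-monoˡ-≤ ν (≤-trans (∣p∩q∣≤∣p∣ S _) S≤t)) ⟩
        ∣ privateNbs S s ∣ + t * ν                         ∎
        where
        open ≤-Reasoning
        cover : ∀ {x} → x ∈ H ∩ nb s → x ∈ privateNbs S s ⊎ ∃ λ s′ → s′ ∈ S ∩ ∁ ⁅ s ⁆ × x ∈ nb s′
        cover {x} x∈ with x∈p∩q⁻ H (nb s) x∈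
        ... | x∈H , x∈nb with ∈⟪⟫⁻ (s ~?_) x∈nb
        ... | s~x with any? (λ s′ → (s′ ∈? S) ×-dec (near? x s′ ×-dec ¬? (s′ ≟ᶠ s)))
        ... | yes (s′ , s′∈S , inj₁ refl , x≢s) = contradiction (ind s′∈S s∈S (inj₂ (~-sym s~x))) x≢s
        ... | yes (s′ , s′∈S , inj₂ x~s′ , s′≢s) =
          inj₂ (s′ , ∈-remove⁺ s′∈S s′≢s , ∈⟪⟫⁺ (s′ ~?_) (~-sym x~s′))
        ... | no none = inj₁ (x∈p∩q⁺ (x∈H , ∈⟪⟫⁺ (isPrivate? S s) (inj₂ (~-sym s~x) , λ s′ s′∈S xs′ →
          decidable-stable (s′ ≟ᶠ s) λ s′≢s → none (s′ , s′∈S , xs′ , s′≢s))))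
        small : ∀ {s′} → s′ ∈ S ∩ ∁ ⁅ s ⁆ → ∣ (H ∩ nb s) ∩ nb s′ ∣ ≤ ν
        small {s′} s′∈ with ∈-remove⁻ S s′∈
        ... | s′∈S , s′≢s = ≤-trans
          (p⊆q⇒∣p∣≤∣q∣ λ x∈ → let x∈₁ , x∈₂ = x∈p∩q⁻ (H ∩ nb s) (nb s′) x∈ in
            x∈p∩q⁺ (proj₂ (x∈p∩q⁻ H (nb s) x∈₁) , x∈₂))
          (<⇒≤ (sparse s s′ (λ ss′ → s′≢s (sym (ind s∈S s′∈S ss′)))))

      half : ∀ {p} → λᵢ ≤ p + t * ν → λᵢ ≤ 2 * p
      half {p} h = +-cancelʳ-≤ λᵢ λᵢ (2 * p) (begin
        λᵢ + λᵢ                ≤⟨ +-mono-≤ h h ⟩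
        (p + t * ν) + (p + t * ν)
                               ≡⟨ double p (t * ν) ⟩
        2 * p + 2 * (t * ν)    ≤⟨ +-monoʳ-≤ (2 * p) (≤-trans (*-monoˡ-≤ (t * ν) {2} {8} (s≤s (s≤s z≤n))) t-small) ⟩
        2 * p + λᵢ             ∎)
        where
        open ≤-Reasoning
        double : ∀ a b → (a + b) + (a + b) ≡ 2 * a + 2 * b
        double = solve-∀

      -- The private neighbourhoods are disjoint subsets of H of size at least λᵢ / 2.
      indep-small : ∀ {S} → S ⊆ H → Indep S → ∣ S ∣ ≤ t → ∣ S ∣ < t
      indep-small {S} S⊆H ind S≤t = ≤∧≢⇒< S≤t λ S≡t → <⇒≱ t-large (begin
        t * λᵢ                                       ≡⟨ cong (_* λᵢ) S≡t ⟨
        ∣ S ∣ * λᵢ                                   ≡⟨ ∑-const S λᵢ ⟨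
        ∑ S (λ _ → λᵢ)                               ≤⟨ ∑-mono S (λ s∈S → half (private-large S⊆H ind S≤t s∈S)) ⟩
        ∑ S (λ s → 2 * ∣ privateNbs S s ∣)             ≡⟨ ∑-*ˡ S 2 (λ s → ∣ privateNbs S s ∣) ⟩
        2 * ∑ S (λ s → ∣ privateNbs S s ∣)             ≤⟨ *-monoʳ-≤ 2 disjoint ⟩
        2 * ∣ H ∣                                    ∎)
        where
        open ≤-Reasoning
        G? : ∀ x → Decidable (λ s → IsPrivate S s x)
        G? x s = isPrivate? S s x
        disjoint : ∑ S (λ s → ∣ privateNbs S s ∣) ≤ ∣ H ∣
        disjoint = begin
          ∑ S (λ s → ∣ privateNbs S s ∣)      ≤⟨ double-count-≤ S H (λ s → ⟪ isPrivate? S s ⟫) (λ x → ⟪ G? x ⟫)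
                                                (λ {s} {x} _ _ x∈ → ∈⟪⟫⁺ (G? x) (∈⟪⟫⁻ (isPrivate? S s) x∈)) ⟩
          ∑ H (λ x → ∣ S ∩ ⟪ G? x ⟫ ∣)      ≤⟨ ∑-mono H (λ {x} _ → ∣∣≤1 (unique x)) ⟩
          ∑ H (λ _ → 1)                     ≡⟨ ∣∣-∑ H ⟨
          ∣ H ∣                             ∎
          where
          unique : ∀ x {s s′} → s ∈ S ∩ ⟪ G? x ⟫ → s′ ∈ S ∩ ⟪ G? x ⟫ → s ≡ s′
          unique x {s} {s′} s∈ s′∈ with x∈p∩q⁻ S ⟪ G? x ⟫ s∈ | x∈p∩q⁻ S ⟪ G? x ⟫ s′∈
          ... | s∈S , s∈G | s′∈S , s′∈G =
            proj₂ (∈⟪⟫⁻ (G? x) s′∈G) s s∈S (proj₁ (∈⟪⟫⁻ (G? x) s∈G))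

      indep-insert : ∀ {S x} → Indep S → (∀ {z} → z ∈ S → ¬ Near x z) → Indep (S ∪ ⁅ x ⁆)
      indep-insert {S} {x} ind far {y} {z} y∈ z∈ yz with x∈p∪q⁻ S ⁅ x ⁆ y∈ | x∈p∪q⁻ S ⁅ x ⁆ z∈
      ... | inj₁ y∈S | inj₁ z∈S = ind y∈S z∈S yz
      ... | inj₁ y∈S | inj₂ z∈x with x∈⁅y⁆⇒x≡y x z∈x
      ... | refl = contradiction (near-sym yz) (far y∈S)
      indep-insert {S} {x} ind far {y} {z} y∈ z∈ yz | inj₂ y∈x | inj₁ z∈S with x∈⁅y⁆⇒x≡y x y∈x
      ... | refl = contradiction yz (far z∈S)
      indep-insert {S} {x} ind far {y} {z} y∈ z∈ yz | inj₂ y∈x | inj₂ z∈x =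
        trans (x∈⁅y⁆⇒x≡y x y∈x) (sym (x∈⁅y⁆⇒x≡y x z∈x))

      insert-⊆ : ∀ {S x} → S ⊆ H → x ∈ H → S ∪ ⁅ x ⁆ ⊆ H
      insert-⊆ {S} {x} S⊆H x∈H y∈ with x∈p∪q⁻ S ⁅ x ⁆ y∈
      ... | inj₁ y∈S = S⊆H y∈S
      ... | inj₂ y∈x = subst (_∈ H) (sym (x∈⁅y⁆⇒x≡y x y∈x)) x∈H

      far⇒∉ : ∀ {S : Subset n} {x} → (∀ {z} → z ∈ S → ¬ Near x z) → x ∉ S
      far⇒∉ far x∈S = far x∈S (inj₁ refl)

      module _ (v : Fin n) (v∈H : v ∈ H) where

        -- A large clique to which `v` is complete; `v` itself may lie outside it.
        record Core : Set where
          field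
            P : Subset n
            P⊆H : P ⊆ H
            P-clique : Clique P
            P-large : λᵢ ≤ ∣ P ∣ + t * ν
            P-near : Complete v P

        -- The bound on the size is weak because an insertion only guarantees this much;
        -- `indep-small` then makes it strict, leaving room for the next insertion.
        record IndepSet : Set where
          field
            S : Subset n
            S⊆H : S ⊆ H
            indep : Indep S
            S≤t : ∣ S ∣ ≤ t

        open IndepSet

        ∣_∣ᴵ : IndepSet → ℕ
        ∣ I ∣ᴵ = ∣ S I ∣

        nbs-of-v : IndepSet → ℕ
        nbs-of-v I = ∣ S I ∩ nb v ∣

        insert : (I : IndepSet) {S₀ : Subset n} {x : Fin n} → S₀ ⊆ S I → (∀ {z} → z ∈ S₀ → ¬ Near x z) →
          x ∈ H → suc ∣ S₀ ∣ ≤ t → IndepSet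
        insert I {S₀} {x} S₀⊆S far x∈H <t = record
          { S = S₀ ∪ ⁅ x ⁆
          ; S⊆H = insert-⊆ (λ z∈ → S⊆H I (S₀⊆S z∈)) x∈H
          ; indep = indep-insert (λ y∈ z∈ → indep I (S₀⊆S y∈) (S₀⊆S z∈)) far
          ; S≤t = subst (_≤ t) (sym (∣∣-insert (far⇒∉ far))) <t
          }

        -- Progress is lexicographic: first a larger set, then fewer members adjacent to `v`.
        Step : IndepSet → Set
        Step I = Core
               ⊎ (∃ λ I′ → ∣ I′ ∣ᴵ ≡ suc ∣ I ∣ᴵ)
               ⊎ (∃ λ I′ → ∣ I′ ∣ᴵ ≡ ∣ I ∣ᴵ × nbs-of-v I′ < nbs-of-v I)

        private-far : ∀ I {s p z} → p ∈ privateNbs (S I) s → z ∈ S I ∩ ∁ ⁅ s ⁆ → ¬ Near p z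
        private-far I {s} p∈ z∈ pz with ∈-remove⁻ (S I) z∈
        ... | z∈S , z≢s = z≢s (proj₂ (proj₂ (∈private⁻ (S I) s p∈)) _ z∈S pz)

        -- Replacing `s` by `p` keeps independence, as `p` is private to `s`; the neighbor `s` of
        -- `v` is lost and none is gained.
        exchange : ∀ I {s p} → s ∈ S I → Near s v → p ∈ privateNbs (S I) s → ¬ Near p v →
          ∃ λ I′ → ∣ I′ ∣ᴵ ≡ ∣ I ∣ᴵ × nbs-of-v I′ < nbs-of-v I
        exchange I {s} {p} s∈S sv p∈P ¬pv = I′ , size , fewer
          where
          S∖s : Subset n
          S∖s = S I ∩ ∁ ⁅ s ⁆
          p-priv : p ∈ H × IsPrivate (S I) s p
          p-priv = ∈private⁻ (S I) s p∈P
          I′ : IndepSet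
          I′ = insert I (λ x∈ → proj₁ (∈-remove⁻ (S I) x∈)) (private-far I p∈P) (proj₁ p-priv)
            (subst (_≤ t) (∣∣-remove s∈S) (S≤t I))
          size : ∣ I′ ∣ᴵ ≡ ∣ I ∣ᴵ
          size = trans (∣∣-insert (far⇒∉ (private-far I p∈P))) (sym (∣∣-remove s∈S))
          s~v : s ~ v
          -- Equality of `s` and `v` is excluded, since `p` is near `s` but not near `v`.
          s~v = [ (λ s≡v → contradiction (subst (Near p) s≡v (proj₁ (proj₂ p-priv))) ¬pv) , id ] sv
          sub : S I′ ∩ nb v ⊆ (S I ∩ nb v) ∩ ∁ ⁅ s ⁆
          sub {x} x∈ with x∈p∩q⁻ (S I′) (nb v) x∈
          ... | x∈S′ , x∈nb with x∈p∪q⁻ S∖s ⁅ p ⁆ x∈S′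
          ... | inj₁ x∈S∖s = let x∈S , x≢s = ∈-remove⁻ (S I) x∈S∖s in
            ∈-remove⁺ (x∈p∩q⁺ (x∈S , x∈nb)) x≢s
          ... | inj₂ x∈p with x∈⁅y⁆⇒x≡y p x∈p
          ... | refl = contradiction (near-sym (inj₂ (∈⟪⟫⁻ (v ~?_) x∈nb))) ¬pv
          fewer : nbs-of-v I′ < nbs-of-v I
          fewer = ≤-trans (s≤s (p⊆q⇒∣p∣≤∣q∣ sub))
            (≤-reflexive (sym (∣∣-remove (x∈p∩q⁺ (s∈S , ∈⟪⟫⁺ (v ~?_) (~-sym s~v))))))

        -- Two nonadjacent private neighbors of `s` can replace `s` together.
        split : ∀ I {s x y} → s ∈ S I → x ∈ privateNbs (S I) s → y ∈ privateNbs (S I) s → ¬ Near x y →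
          ∃ λ I′ → ∣ I′ ∣ᴵ ≡ suc ∣ I ∣ᴵ
        split I {s} {x} {y} s∈S x∈ y∈ ¬xy = I₂ , size₂
          where
          S∖s : Subset n
          S∖s = S I ∩ ∁ ⁅ s ⁆
          I₁ I₂ : IndepSet
          I₁ = insert I (λ z∈ → proj₁ (∈-remove⁻ (S I) z∈)) (private-far I x∈)
            (proj₁ (∈private⁻ (S I) s x∈)) (subst (_≤ t) (∣∣-remove s∈S) (S≤t I))
          far : ∀ {z} → z ∈ S I₁ → ¬ Near y z
          far z∈ yz with x∈p∪q⁻ S∖s ⁅ x ⁆ z∈
          ... | inj₁ z∈S∖s = private-far I y∈ z∈S∖s yz
          ... | inj₂ z∈x with x∈⁅y⁆⇒x≡y x z∈x
          ... | refl = ¬xy (near-sym yz)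
          size₁ : ∣ I₁ ∣ᴵ ≡ ∣ I ∣ᴵ
          size₁ = trans (∣∣-insert (far⇒∉ (private-far I x∈))) (sym (∣∣-remove s∈S))
          I₂ = insert I₁ id far (proj₁ (∈private⁻ (S I) s y∈)) (indep-small (S⊆H I₁) (indep I₁) (S≤t I₁))
          size₂ : ∣ I₂ ∣ᴵ ≡ suc ∣ I ∣ᴵ
          size₂ = trans (∣∣-insert (far⇒∉ far)) (cong suc size₁)

        -- If no member is near `v`, then `v` can be added. Otherwise the private neighborhood of a
        -- member `s` near `v` is a core, unless a vertex not near `v` allows an exchange or a
        -- nonadjacent pair a split.
        step : ∀ I → Step I
        step I with any? (λ s → (s ∈? S I) ×-dec near? s v)
        ... | no none = inj₂ (inj₁ (insert I id far v∈H (indep-small (S⊆H I) (indep I) (S≤t I)) ,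
                                    ∣∣-insert (far⇒∉ far)))
          where
          far : ∀ {z} → z ∈ S I → ¬ Near v z
          far z∈S vz = none (_ , z∈S , near-sym vz)
        ... | yes (s , s∈S , sv) with any? (λ p → (p ∈? privateNbs (S I) s) ×-dec ¬? (near? p v))
        ... | yes (p , p∈P , ¬pv) = inj₂ (inj₂ (exchange I s∈S sv p∈P ¬pv))
        ... | no v-complete with any? (λ x → any? (λ y →
                (x ∈? privateNbs (S I) s) ×-dec ((y ∈? privateNbs (S I) s) ×-dec ¬? (near? x y))))
        ... | yes (x , y , x∈ , y∈ , ¬xy) = inj₂ (inj₁ (split I s∈S x∈ y∈ ¬xy))
        ... | no clique = inj₁ record
          { P = privateNbs (S I) s
          ; P⊆H = λ x∈ → proj₁ (∈private⁻ (S I) s x∈)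
          ; P-clique = λ {x} {y} x∈ y∈ → decidable-stable (near? x y) λ ¬xy → clique (x , y , x∈ , y∈ , ¬xy)
          ; P-large = private-large (S⊆H I) (indep I) (S≤t I) s∈S
          ; P-near = λ {y} y∈ → near-sym (decidable-stable (near? y v) λ ¬yv → v-complete (y , y∈ , ¬yv))
          }

        -- a bounds how often the set can still grow, b how often it can be exchanged before growing.
        improve : ∀ a b (I : IndepSet) → t ≤ ∣ I ∣ᴵ + a → nbs-of-v I ≤ b → Core
        improve a b I t≤ ≤b with step I
        ... | inj₁ core = core
        improve zero b I t≤ ≤b | inj₂ (inj₁ _) =
          contradiction (subst (t ≤_) (+-identityʳ _) t≤) (<⇒≱ (indep-small (S⊆H I) (indep I) (S≤t I)))
        improve (suc a) b I t≤ ≤b | inj₂ (inj₁ (I′ , size)) =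
          improve a n I′ (subst (t ≤_) (trans (+-suc _ _) (cong (_+ a) (sym size))) t≤) (∣p∣≤n (S I′ ∩ nb v))
        improve a zero I t≤ ≤b | inj₂ (inj₂ (I′ , size , fewer)) = contradiction (≤-trans fewer ≤b) λ ()
        improve a (suc b) I t≤ ≤b | inj₂ (inj₂ (I′ , size , fewer)) =
          improve a b I′ (subst (λ k → t ≤ k + a) (sym size) t≤) (≤-pred (≤-trans fewer ≤b))

        t-pos : 1 ≤ t
        t-pos = n≢0⇒n>0 λ t≡0 → n≮0 (subst (λ k → 2 * ∣ H ∣ < k * λᵢ) t≡0 t-large)

        core : Core
        core = improve t n (record
          { S = ∅
          ; S⊆H = λ x∈ → contradiction x∈ ∉⊥
          ; indep = λ x∈ → contradiction x∈ ∉⊥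
          ; S≤t = subst (_≤ t) (sym (∣⊥∣≡0 n)) z≤n
          }) (m≤n+m t _) (∣p∣≤n (∅ ∩ nb v))

        -- The core is enlarged to all vertices of `H` complete to it, `v` among them. A vertex of
        -- `H` left out misses some `x` of the core, and `x` is near the whole clique, so `few-nbs`
        -- applies.
        localClique : ∃ (IsLocalClique H λᵢ (t * ν) v)
        localClique = C , record
          { ⊆H = λ x∈ → proj₁ (C⁻ x∈)
          ; ∋v = C⁺ v∈H P-near
          ; clique = clique
          ; few = few
          ; lower = ≤-trans P-large (+-monoˡ-≤ (t * ν) (p⊆q⇒∣p∣≤∣q∣ λ x∈P → C⁺ (P⊆H x∈P) (P-clique x∈P)))
          ; upper = begin
              ∣ C ∣                       ≤⟨ ∣∣-cover near-v ⟩
              ∣ ⁅ v ⁆ ∣ + ∣ H ∩ nb v ∣    ≡⟨ cong₂ _+_ (∣⁅x⁆∣≡1 v) (regular v∈H) ⟩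
              suc λᵢ                      ∎
          }
          where
          open ≤-Reasoning
          open Core core
          complete? : Decidable (λ w → ∀ x → x ∈ P → Near w x)
          complete? w = all? λ x → (x ∈? P) →-dec near? w x
          C : Subset n
          C = H ∩ ⟪ complete? ⟫
          C⁻ : ∀ {x} → x ∈ C → x ∈ H × Complete x P
          C⁻ x∈ with x∈p∩q⁻ H ⟪ complete? ⟫ x∈
          ... | x∈H , x∈K = x∈H , λ {y} → ∈⟪⟫⁻ complete? x∈K y
          C⁺ : ∀ {x} → x ∈ H → Complete x P → x ∈ C
          C⁺ x∈H xP = x∈p∩q⁺ (x∈H , ∈⟪⟫⁺ complete? λ y y∈ → xP y∈)
          ν≤P : ν ≤ ∣ P ∣
          ν≤P = *-cancelˡ-≤ 2 (begin
            2 * ν         ≤⟨ *-monoˡ-≤ ν {2} {8} (s≤s (s≤s z≤n)) ⟩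
            8 * ν         ≡⟨ cong (8 *_) (*-identityˡ ν) ⟨
            8 * (1 * ν)   ≤⟨ *-monoʳ-≤ 8 (*-monoˡ-≤ ν t-pos) ⟩
            8 * (t * ν)   ≤⟨ t-small ⟩
            λᵢ            ≤⟨ half P-large ⟩
            2 * ∣ P ∣     ∎)
          clique : Clique C
          clique x∈ y∈ = near-of-common (proj₂ (C⁻ x∈)) (proj₂ (C⁻ y∈)) ν≤P
          few : ∀ {w} → w ∈ H → w ∉ C → ∣ nb w ∩ C ∣ < ν
          few {w} w∈H w∉C with any? (λ x → (x ∈? P) ×-dec ¬? (near? w x))
          ... | yes (x , x∈P , ¬wx) = few-nbs (λ y∈C → near-sym (proj₂ (C⁻ y∈C) x∈P)) ¬wx
          ... | no none = contradiction (C⁺ w∈H λ {y} y∈P →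
            decidable-stable (near? w y) λ ¬wy → none (y , y∈P , ¬wy)) w∉C
          near-v : ∀ {x} → x ∈ C → x ∈ ⁅ v ⁆ ⊎ x ∈ H ∩ nb v
          near-v {x} x∈ = [ (λ v≡x → inj₁ (subst (_∈ ⁅ v ⁆) v≡x (x∈⁅x⁆ v)))
                          , (λ v~x → inj₂ (x∈p∩q⁺ (proj₁ (C⁻ x∈) , ∈⟪⟫⁺ (v ~?_) v~x)))
                          ] (clique (C⁺ v∈H P-near) x∈)

-- Gluing the local cliques

-- Coherence enters through `codegree`: the number of neighbors of `w` in a color class at `u`
-- depends only on the color of `(u , w)`.
module Geometry {n r : ℕ} (c : Coloring n r)
  (adj-sym : ∀ {u v} → Adj c u v → Adj c v u)
  (adj-color : ∀ {u v w} → Adj c u v → c u w ≡ c u v → Adj c u w)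
  (codegree : ∀ j {u w w′} → c u w ≡ c u w′ → ∣ X c j u ∩ N c w ∣ ≡ ∣ X c j u ∩ N c w′ ∣)
  where

  open Graph (Adj c) (adj? c) adj-sym public

  -- `ρν-small` is the estimate that ρμ is small against Λ², with a constant that suffices for the
  -- counts in `matching` and `clique-meets-part`.
  module Bounds (ν : ℕ) (sparse : ∀ x y → ¬ Near x y → ∣ nb x ∩ nb y ∣ < ν) (1≤ν : 1 ≤ ν)
    (ρ′ : ℕ) (valency : ∀ u → ∣ nb u ∣ ≤ ρ′)
    (Λ : ℕ) (1≤Λ : 1 ≤ Λ) (Λ≤lam : ∀ {u v} → Adj c u v → Λ ≤ lam c u v)
    (ρν-small : 32 * (ρ′ * ν) ≤ Λ * Λ) where

    open Sparse ν sparse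

    -- The partition of a color class into parts

    class : Fin n → Fin n → Subset n
    class u v = X c (c u v) u

    class⁻ : ∀ {u v x} → x ∈ class u v → c u x ≡ c u v
    class⁻ {u} {v} = ∈⟪⟫⁻ (λ x → c u x ≟ᶠ c u v)

    class⁺ : ∀ {u v x} → c u x ≡ c u v → x ∈ class u v
    class⁺ {u} {v} = ∈⟪⟫⁺ (λ x → c u x ≟ᶠ c u v)

    nb⁻ : ∀ {u x} → x ∈ nb u → Adj c u x
    nb⁻ {u} = ∈⟪⟫⁻ (adj? c u)

    nb⁺ : ∀ {u x} → Adj c u x → x ∈ nb u
    nb⁺ {u} = ∈⟪⟫⁺ (adj? c u)

    class⊆nb : ∀ {u v} → Adj c u v → class u v ⊆ nb u
    class⊆nb uv x∈ = nb⁺ (adj-color uv (class⁻ x∈))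

    lam-class : ∀ {u v w} → c u w ≡ c u v → lam c u w ≡ lam c u v
    lam-class {u} {v} {w} eq = trans (cong (λ j → ∣ X c j u ∩ nb w ∣) eq) (codegree (c u v) eq)

    24ρν-small : 3 * (8 * (ρ′ * ν)) ≤ Λ * Λ
    24ρν-small = begin
      3 * (8 * (ρ′ * ν))     ≡⟨ *-assoc 3 8 (ρ′ * ν) ⟨
      24 * (ρ′ * ν)          ≤⟨ *-monoˡ-≤ (ρ′ * ν) {24} {32} (m≤m+n 24 8) ⟩
      32 * (ρ′ * ν)          ≤⟨ ρν-small ⟩
      Λ * Λ                  ∎
      where open ≤-Reasoning

    -- e-small is kept for every M, so that one part serves all accuracies 1 / M.
    record IsPart (u v : Fin n) (C : Subset n) : Set where
      field
        e : ℕ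
        isLocal : IsLocalClique (class u v) (lam c u v) e v C
        e-small : ∀ M → 3 * (M * (ρ′ * ν)) ≤ Λ * Λ → M * e ≤ lam c u v
        ν≤e : ν ≤ e
      open IsLocalClique isLocal public

      8e≤lam : 8 * e ≤ lam c u v
      8e≤lam = e-small 8 24ρν-small

      half : lam c u v ≤ 2 * ∣ C ∣
      half = *-cancelˡ-≤ 4 (+-cancelʳ-≤ (8 * e) (4 * lam c u v) (4 * (2 * ∣ C ∣)) (begin
        4 * l + 8 * e                 ≤⟨ +-monoʳ-≤ (4 * l) 8e≤lam ⟩
        4 * l + l                     ≤⟨ +-monoʳ-≤ (4 * l) (m≤m+n l (3 * l)) ⟩
        4 * l + 4 * l                 ≤⟨ +-mono-≤ (*-monoʳ-≤ 4 lower) (*-monoʳ-≤ 4 lower) ⟩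
        4 * (∣ C ∣ + e) + 4 * (∣ C ∣ + e) ≡⟨ expand (∣ C ∣) e ⟩
        4 * (2 * ∣ C ∣) + 8 * e       ∎))
        where
        open ≤-Reasoning
        l = lam c u v
        expand : ∀ a e → 4 * (a + e) + 4 * (a + e) ≡ 4 * (2 * a) + 8 * e
        expand = solve-∀

      ν≤C : ν ≤ ∣ C ∣
      ν≤C = *-cancelˡ-≤ 8 (begin
        8 * ν          ≤⟨ *-monoʳ-≤ 8 ν≤e ⟩
        8 * e          ≤⟨ 8e≤lam ⟩
        lam c u v      ≤⟨ half ⟩
        2 * ∣ C ∣      ≤⟨ *-monoˡ-≤ ∣ C ∣ {2} {8} (m≤m+n 2 6) ⟩
        8 * ∣ C ∣      ∎)
        where open ≤-Reasoning

    -- The bound `t` on independent sets is about `2 * k / l`, rounded up; hence `t * l` is at most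
    -- `3 * ρ′`, and the error is `t * ν`.
    part : ∀ {u v} → Adj c u v → ∃ (IsPart u v)
    part {u} {v} uv = proj₁ local , record
      { e = t * ν
      ; isLocal = proj₂ local
      ; e-small = t-bound
      ; ν≤e = subst (_≤ t * ν) (*-identityˡ ν) (*-monoˡ-≤ ν t-pos)
      }
      where
      open ≤-Reasoning
      l k t : ℕ
      l = lam c u v
      k = ∣ class u v ∣
      1≤l : 1 ≤ l
      1≤l = ≤-trans 1≤Λ (Λ≤lam uv)
      multiple : ∃ λ t → 2 * k < t * l × t * l ≤ 2 * k + l
      multiple = multiple-above (2 * k) l 1≤l
      t = proj₁ multiple
      k≤ρ : k ≤ ρ′
      k≤ρ = ≤-trans (p⊆q⇒∣p∣≤∣q∣ (class⊆nb uv)) (valency u)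
      tl≤ : t * l ≤ 3 * ρ′
      tl≤ = begin
        t * l          ≤⟨ proj₂ (proj₂ multiple) ⟩
        2 * k + l      ≤⟨ +-mono-≤ (*-monoʳ-≤ 2 k≤ρ) (≤-trans (∣p∩q∣≤∣p∣ (class u v) (nb v)) k≤ρ) ⟩
        2 * ρ′ + ρ′    ≡⟨ +-comm (2 * ρ′) ρ′ ⟩
        3 * ρ′         ∎
      -- After multiplication by `l`, the factor `t * l` can be replaced by its bound `3 * ρ′`.
      t-bound : ∀ M → 3 * (M * (ρ′ * ν)) ≤ Λ * Λ → M * (t * ν) ≤ l
      t-bound M small = *-cancelʳ-≤ (M * (t * ν)) l l {{>-nonZero 1≤l}} (begin
        M * (t * ν) * l        ≡⟨ rearrange₁ M t ν l ⟩
        M * (t * l * ν)        ≤⟨ *-monoʳ-≤ M (*-monoˡ-≤ ν tl≤) ⟩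
        M * (3 * ρ′ * ν)       ≡⟨ rearrange₂ M ρ′ ν ⟩
        3 * (M * (ρ′ * ν))     ≤⟨ small ⟩
        Λ * Λ                  ≤⟨ *-mono-≤ (Λ≤lam uv) (Λ≤lam uv) ⟩
        l * l                  ∎)
        where
        rearrange₁ : ∀ M t ν l → M * (t * ν) * l ≡ M * (t * l * ν)
        rearrange₁ = solve-∀
        rearrange₂ : ∀ M r ν → M * (3 * r * ν) ≡ 3 * (M * (r * ν))
        rearrange₂ = solve-∀
      t-small : 8 * (t * ν) ≤ l
      t-small = t-bound 8 24ρν-small
      module M = Metsch (class u v) l t (λ x∈ → codegree (c u v) (class⁻ x∈)) (proj₁ (proj₂ multiple)) t-small
      local : ∃ (IsLocalClique (class u v) l (t * ν) v)
      local = M.localClique v (class⁺ refl)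
      t-pos : 1 ≤ t
      t-pos = M.t-pos v (class⁺ refl)

    -- The empty default makes `P u` a family of sets indexed by all vertices, as the double counts
    -- require.
    part-or-∅ : ∀ {u v} → Dec (Adj c u v) → Subset n
    part-or-∅ (yes uv) = proj₁ (part uv)
    part-or-∅ (no _) = ∅

    P : Fin n → Fin n → Subset n
    P u v = part-or-∅ (adj? c u v)

    isPart : ∀ {u v} → Adj c u v → IsPart u v (P u v)
    isPart {u} {v} uv with adj? c u v
    ... | yes uv′ = proj₂ (part uv′)
    ... | no ¬uv = contradiction uv ¬uv

    module _ {u v : Fin n} (uv : Adj c u v) where
      open IsPart (isPart uv) public
        renaming (⊆H to P⊆class; ∋v to ∈P; clique to P-clique; few to P-few; lower to P-lower;
                  upper to P-upper; half to P-half; ν≤C to ν≤P; 8e≤lam to P-8e; ν≤e to P-ν≤e;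
                  e to P-err; e-small to P-err-small)

    part-color : ∀ {u v x} → Adj c u v → x ∈ P u v → c u x ≡ c u v
    part-color uv x∈ = class⁻ (P⊆class uv x∈)

    part-adj : ∀ {u v x} → Adj c u v → x ∈ P u v → Adj c u x
    part-adj uv x∈ = adj-color uv (part-color uv x∈)

    -- Outside its part, a vertex of the class has fewer than `ν` neighbors in it, which is less
    -- than the size of the part.
    absorb : ∀ {u v w} → Adj c u v → c u w ≡ c u v → Complete w (P u v) → w ∈ P u v
    absorb {u} {v} {w} uv eq wP = decidable-stable (w ∈? P u v) λ w∉P →
      <⇒≱ (P-few uv (class⁺ eq) w∉P) (≤-trans (ν≤P uv) (p⊆q⇒∣p∣≤∣q∣ λ y∈ →
        x∈p∩q⁺ {p = nb w} (complete⇒⊆nb wP w∉P y∈ , y∈)))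

    -- Both parts lie in `Hull`, which has only `suc l` vertices, and each nearly fills it, so they
    -- overlap in at least `ν` vertices. A vertex `x` of the first part outside the second would be
    -- adjacent to the whole overlap.
    part-mono : ∀ {u v w} → Adj c u v → w ∈ P u v → P u v ⊆ P u w
    part-mono {u} {v} {w} uv w∈ {x} x∈ = decidable-stable (x ∈? P u w) λ x∉ →
      <⇒≱ (P-few uw (class⁺ (trans (part-color uv x∈) (sym w-color))) x∉)
        (≤-trans ν≤o (p⊆q⇒∣p∣≤∣q∣ (near⇒nb x∉)))
      where
      open ≤-Reasoning
      uw : Adj c u w
      uw = part-adj uv w∈
      w-color : c u w ≡ c u v
      w-color = part-color uv w∈
      l e e′ : ℕ
      l = lam c u v
      e = P-err uv
      e′ = P-err uw
      near⇒nb : x ∉ P u w → P u v ∩ P u w ⊆ nb x ∩ P u w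
      near⇒nb x∉ y∈ with x∈p∩q⁻ (P u v) (P u w) y∈
      ... | y∈v , y∈w = x∈p∩q⁺ ([ (λ x≡y → contradiction (subst (_∈ P u w) (sym x≡y) y∈w) x∉) , nb⁺ ]
        (P-clique uv x∈ y∈v) , y∈w)
      Hull : Subset n
      Hull = ⁅ w ⁆ ∪ (class u v ∩ nb w)
      hull : ∀ {y} → c u y ≡ c u v → Near w y → y ∈ Hull
      hull eq (inj₁ refl) = x∈p∪q⁺ (inj₁ (x∈⁅x⁆ w))
      hull eq (inj₂ wy) = x∈p∪q⁺ (inj₂ (x∈p∩q⁺ (class⁺ eq , nb⁺ wy)))
      hull-size : ∣ Hull ∣ ≤ suc l
      hull-size = begin
        ∣ Hull ∣                            ≤⟨ ∣∣-cover (x∈p∪q⁻ ⁅ w ⁆ (class u v ∩ nb w)) ⟩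
        ∣ ⁅ w ⁆ ∣ + ∣ class u v ∩ nb w ∣    ≡⟨ cong₂ _+_ (∣⁅x⁆∣≡1 w) (codegree (c u v) w-color) ⟩
        suc l                               ∎
      o : ℕ
      o = ∣ P u v ∩ P u w ∣
      sizes : l + l ≤ (o + suc l) + (e + e′)
      sizes = begin
        l + l
          ≤⟨ +-mono-≤ (P-lower uv) (subst (_≤ ∣ P u w ∣ + e′) (lam-class w-color) (P-lower uw)) ⟩
        (∣ P u v ∣ + e) + (∣ P u w ∣ + e′)     ≡⟨ swap-middle (∣ P u v ∣) e (∣ P u w ∣) e′ ⟩
        (∣ P u v ∣ + ∣ P u w ∣) + (e + e′)     ≤⟨ +-monoˡ-≤ (e + e′) (∣∣-incl-excl {A = Hull}
              (λ y∈ → hull (part-color uv y∈) (P-clique uv w∈ y∈))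
              (λ y∈ → hull (trans (part-color uw y∈) w-color) (P-clique uw (∈P uw) y∈))) ⟩
        (o + ∣ Hull ∣) + (e + e′)              ≤⟨ +-monoˡ-≤ (e + e′) (+-monoʳ-≤ o hull-size) ⟩
        (o + suc l) + (e + e′)                 ∎
        where
        swap-middle : ∀ a b c d → (a + b) + (c + d) ≡ (a + c) + (b + d)
        swap-middle = solve-∀
      ν≤o : ν ≤ o
      -- A smaller overlap would give `l ≤ ν + (e + e′)`, but each of these three terms is at most
      -- an eighth of `l`.
      ν≤o = ≮⇒≥ λ o<ν → <⇒≱ (begin-strict
        8 * (ν + (e + e′))            ≤⟨ *-monoʳ-≤ 8 (+-monoˡ-≤ (e + e′) (P-ν≤e uv)) ⟩
        8 * (e + (e + e′))            ≡⟨ expand e e′ ⟩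
        8 * e + (8 * e + 8 * e′)
          ≤⟨ +-mono-≤ (P-8e uv) (+-mono-≤ (P-8e uv) (subst (8 * e′ ≤_) (lam-class w-color) (P-8e uw))) ⟩
        l + (l + l)                   <⟨ m<m+n (l + (l + l)) (≤-trans (≤-trans 1≤Λ (Λ≤lam uv)) (m≤m+n l (4 * l))) ⟩
        (l + (l + l)) + 5 * l         ≡⟨ collect l ⟩
        8 * l                         ∎)
        (*-monoʳ-≤ 8 (+-cancelʳ-≤ l l (ν + (e + e′)) (begin
          l + l                       ≤⟨ sizes ⟩
          (o + suc l) + (e + e′)      ≡⟨ shift o l (e + e′) ⟩
          (suc o + (e + e′)) + l      ≤⟨ +-monoˡ-≤ l (+-monoˡ-≤ (e + e′) o<ν) ⟩
          (ν + (e + e′)) + l          ∎)))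
        where
        expand : ∀ e e′ → 8 * (e + (e + e′)) ≡ 8 * e + (8 * e + 8 * e′)
        expand = solve-∀
        collect : ∀ l → (l + (l + l)) + 5 * l ≡ 8 * l
        collect = solve-∀
        shift : ∀ o l e → (o + suc l) + e ≡ (suc o + e) + l
        shift = solve-∀

    -- Together with `part-mono` this makes the parts at `u` classes of an equivalence relation on
    -- its neighbors.
    part-sym : ∀ {u v w} → Adj c u v → w ∈ P u v → v ∈ P u w
    part-sym uv w∈ = part-mono uv w∈ (∈P uv)

    -- Suppose no part D of color j = c u w at u is complete to C = P u v. Then each D sends at most
    -- ν (2 λⱼ + |C|) edges to C. But every vertex of 𝔛ⱼ(u) has as many neighbors in 𝔛ᵢ(u) as w,
    -- hence at least |C|, and this gives too many edges between C and 𝔛ⱼ(u).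
    matching : ∀ {u v w} → Adj c u v → Adj c u w → Complete w (P u v) → ∀ {x} → x ∈ P u w → Complete x (P u v)
    matching {u} {v} {w} uv uw wP with c u w ≟ᶠ c u v
    -- For equal colors `w` is absorbed into the part of `v`, so the two parts coincide.
    ... | yes eq = λ x∈ → P-clique uv (part-mono uw (part-sym uv (absorb uv eq wP)) x∈)
    ... | no ≢color with any? (λ y → (y ∈? class u w) ×-dec all? (λ x → (x ∈? P u y) →-dec
                                all? (λ z → (z ∈? P u v) →-dec near? x z)))
    -- Some part of this color is complete to `P u v`. As `w` is too, `w` is near every vertex of
    -- that part and hence belongs to it.
    ... | yes (y , y∈ , PyP) = λ x∈ z∈ → PyP _ (part-mono uw (part-sym uy w∈Py) x∈) _ z∈
      where
      uy : Adj c u y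
      uy = adj-color uw (class⁻ y∈)
      w∈Py : w ∈ P u y
      w∈Py = absorb uy (sym (class⁻ y∈)) λ {x} x∈ → near-of-common wP (λ {z} z∈ → PyP x x∈ z z∈) (ν≤P uv)
    ... | no none = contradiction final (<⇒≱ 10T<16T)
      where
      open ≤-Reasoning
      I J C : Subset n
      I = class u v
      J = class u w
      C = P u v
      lⱼ d k : ℕ
      lⱼ = lam c u w
      d = ∣ J ∩ nb v ∣
      k = ∣ C ∣
      f : Fin n → ℕ
      f z = ∣ C ∩ nb z ∣
      J-adj : ∀ {y} → y ∈ J → Adj c u y
      J-adj y∈ = adj-color uw (class⁻ y∈)

      f-sum : ∑ J f ≡ k * d
      f-sum = begin-equality
        ∑ J (λ z → ∣ C ∩ nb z ∣)
          ≡⟨ double-count J C nb nb (λ _ _ x∈ → nb⁺ (adj-sym (nb⁻ x∈))) (λ _ _ x∈ → nb⁺ (adj-sym (nb⁻ x∈))) ⟩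
        ∑ C (λ x → ∣ J ∩ nb x ∣)     ≡⟨ ∑-cong C (λ x∈ → codegree (c u w) (part-color uv x∈)) ⟩
        ∑ C (λ _ → d)                ≡⟨ ∑-const C d ⟩
        k * d                        ∎

      C⊆I∩nb : C ⊆ I ∩ nb w
      C⊆I∩nb z∈ = x∈p∩q⁺ (P⊆class uv z∈ , complete⇒⊆nb wP (λ w∈ → ≢color (part-color uv w∈)) z∈)

      -- As `w` is adjacent to all of `C`, every vertex of `J` has at least `k` neighbors in `I`;
      -- from the side of `I` the same edges number `∣ I ∣ * d`.
      edges : ∣ J ∣ * k ≤ ρ′ * d
      edges = begin
        ∣ J ∣ * k                      ≤⟨ *-monoʳ-≤ ∣ J ∣ (p⊆q⇒∣p∣≤∣q∣ C⊆I∩nb) ⟩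
        ∣ J ∣ * ∣ I ∩ nb w ∣           ≡⟨ ∑-const J _ ⟨
        ∑ J (λ _ → ∣ I ∩ nb w ∣)       ≡⟨ ∑-cong J (λ z∈ → codegree (c u v) (class⁻ z∈)) ⟨
        ∑ J (λ z → ∣ I ∩ nb z ∣)       ≤⟨ double-count-≤ J I nb nb (λ _ _ x∈ → nb⁺ (adj-sym (nb⁻ x∈))) ⟩
        ∑ I (λ x → ∣ J ∩ nb x ∣)       ≡⟨ ∑-cong I (λ x∈ → codegree (c u w) (class⁻ x∈)) ⟩
        ∑ I (λ _ → d)                  ≡⟨ ∑-const I d ⟩
        ∣ I ∣ * d                      ≤⟨ *-monoˡ-≤ d (≤-trans (p⊆q⇒∣p∣≤∣q∣ (class⊆nb uv)) (valency u)) ⟩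
        ρ′ * d                         ∎

      completeC? : Decidable (λ z → ∀ x → x ∈ C → Near z x)
      completeC? z = all? λ x → (x ∈? C) →-dec near? z x

      -- More than `ν` vertices complete to `C` would, as common neighbors, force the whole part to
      -- be complete to `C`, against `none`.
      few-complete : ∀ {y} → y ∈ J → ∣ P u y ∩ ⟪ completeC? ⟫ ∣ ≤ ν
      few-complete {y} y∈ = ≮⇒≥ λ ν< → none (y , y∈ , λ x x∈ z z∈ →
        near-of-common {A = P u y ∩ ⟪ completeC? ⟫}
          (λ q∈ → P-clique (J-adj y∈) x∈ (proj₁ (x∈p∩q⁻ (P u y) ⟪ completeC? ⟫ q∈)))
          (λ q∈ → near-sym (∈⟪⟫⁻ completeC? (proj₂ (x∈p∩q⁻ (P u y) ⟪ completeC? ⟫ q∈)) z z∈))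
          (<⇒≤ ν<))

      -- A vertex of the part not complete to `C` sends fewer than `ν` edges to `C`; the at most `ν`
      -- complete ones send up to `k` each.
      part-edges : ∀ {y} → y ∈ J → ∑ (J ∩ P u y) f ≤ ν * (2 * lⱼ + k)
      part-edges {y} y∈ = begin
        ∑ A f                                              ≤⟨ ∑-mono A bound ⟩
        ∑ A (λ z → ν + (if lookup K z then k else 0))      ≡⟨ ∑-+ A (λ _ → ν) _ ⟩
        ∑ A (λ _ → ν) + ∑ A (λ z → if lookup K z then k else 0)
              ≡⟨ cong₂ _+_ (∑-const A ν) (trans (sym (∑-∩ A K (λ _ → k))) (∑-const (A ∩ K) k)) ⟩
        ∣ A ∣ * ν + ∣ A ∩ K ∣ * k                          ≤⟨ +-mono-≤ (*-monoˡ-≤ ν A-size) (*-monoˡ-≤ k AK-size) ⟩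
        2 * lⱼ * ν + ν * k                                 ≡⟨ cong (_+ ν * k) (*-comm (2 * lⱼ) ν) ⟩
        ν * (2 * lⱼ) + ν * k                               ≡⟨ *-distribˡ-+ ν (2 * lⱼ) k ⟨
        ν * (2 * lⱼ + k)                                   ∎
        where
        A K : Subset n
        A = J ∩ P u y
        K = ⟪ completeC? ⟫
        bound : ∀ {z} → z ∈ A → f z ≤ ν + (if lookup K z then k else 0)
        bound {z} z∈ with ν ≤? ∣ nb z ∩ C ∣
        ... | yes ν≤ rewrite []=⇒lookup (∈⟪⟫⁺ completeC? {z} (λ x → few-or-complete (P-clique uv) ν≤)) =
          ≤-trans (∣p∩q∣≤∣p∣ C (nb z)) (m≤n+m k ν)
        ... | no ν≰ = ≤-trans (≤-reflexive (cong ∣_∣ (∩-comm C (nb z)))) (≤-trans (<⇒≤ (≰⇒> ν≰)) (m≤m+n ν _))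
        lam≡ : lam c u y ≡ lⱼ
        lam≡ = lam-class (class⁻ y∈)
        A-size : ∣ A ∣ ≤ 2 * lⱼ
        A-size = begin
          ∣ J ∩ P u y ∣    ≤⟨ ∣p∩q∣≤∣q∣ J (P u y) ⟩
          ∣ P u y ∣        ≤⟨ P-upper (J-adj y∈) ⟩
          suc (lam c u y)  ≡⟨ cong suc lam≡ ⟩
          1 + lⱼ           ≤⟨ +-monoˡ-≤ lⱼ (≤-trans 1≤Λ (Λ≤lam uw)) ⟩
          lⱼ + lⱼ          ≡⟨ cong (lⱼ +_) (+-identityʳ lⱼ) ⟨
          2 * lⱼ           ∎
        AK-size : ∣ A ∩ K ∣ ≤ ν
        AK-size = ≤-trans (p⊆q⇒∣p∣≤∣q∣ λ z∈ → let z∈A , z∈K = x∈p∩q⁻ A K z∈ in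
          x∈p∩q⁺ (proj₂ (x∈p∩q⁻ J (P u y) z∈A) , z∈K)) (few-complete y∈)

      -- The sum over the parts D is taken over y ∈ 𝔛ⱼ(u) with D = P u y, so D is counted |D| times.
      weighted : lⱼ * (k * d) ≤ 2 * (∣ J ∣ * (ν * (2 * lⱼ + k)))
      weighted = begin
        lⱼ * (k * d)                                   ≡⟨ cong (lⱼ *_) f-sum ⟨
        lⱼ * ∑ J f                                     ≡⟨ ∑-*ˡ J lⱼ f ⟨
        ∑ J (λ z → lⱼ * f z)                           ≤⟨ ∑-mono J (λ {z} z∈ → *-monoˡ-≤ (f z) (large z∈)) ⟩
        ∑ J (λ z → 2 * ∣ J ∩ P u z ∣ * f z)
          ≡⟨ ∑-cong J (λ {z} _ → trans (*-assoc 2 (∣ J ∩ P u z ∣) (f z))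
            (cong (2 *_) (sym (∑-const (J ∩ P u z) (f z))))) ⟩
        ∑ J (λ z → 2 * ∑ (J ∩ P u z) (λ _ → f z))      ≡⟨ ∑-*ˡ J 2 _ ⟩
        2 * ∑ J (λ z → ∑ (J ∩ P u z) (λ _ → f z))
          ≤⟨ *-monoʳ-≤ 2 (∑-swap-≤ J J (P u) (P u) (λ z _ → f z) (λ z∈ _ y∈ → part-sym (J-adj z∈) y∈)) ⟩
        2 * ∑ J (λ y → ∑ (J ∩ P u y) f)                ≤⟨ *-monoʳ-≤ 2 (∑-mono J part-edges) ⟩
        2 * ∑ J (λ _ → ν * (2 * lⱼ + k))               ≡⟨ cong (2 *_) (∑-const J _) ⟩
        2 * (∣ J ∣ * (ν * (2 * lⱼ + k)))               ∎
        where
        large : ∀ {z} → z ∈ J → lⱼ ≤ 2 * ∣ J ∩ P u z ∣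
        large {z} z∈ = begin
          lⱼ                     ≡⟨ lam-class (class⁻ z∈) ⟨
          lam c u z              ≤⟨ P-half (J-adj z∈) ⟩
          2 * ∣ P u z ∣
            ≤⟨ *-monoʳ-≤ 2 (p⊆q⇒∣p∣≤∣q∣ λ y∈ → x∈p∩q⁺ (class⁺ (trans (part-color (J-adj z∈) y∈) (class⁻ z∈)) , y∈)) ⟩
          2 * ∣ J ∩ P u z ∣      ∎

      T : ℕ
      T = lⱼ * (k * k)

      -- `edges` and `weighted` both involve `d`; eliminating it and cancelling `∣ J ∣` bounds `T`
      -- by a multiple of `ρ′ * ν`, and then Λ² replaces `32 * (ρ′ * ν)`.
      final : 16 * T ≤ 10 * T
      final = begin
        16 * T                                          ≤⟨ *-monoʳ-≤ 16 T≤ ⟩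
        16 * (2 * (ρ′ * (ν * (2 * lⱼ + k))))            ≡⟨ expand (ρ′) ν lⱼ k ⟩
        2 * (32 * (ρ′ * ν) * lⱼ) + 32 * (ρ′ * ν) * k
          ≤⟨ +-mono-≤ (*-monoʳ-≤ 2 (*-monoˡ-≤ lⱼ ρν-small)) (*-monoˡ-≤ k ρν-small) ⟩
        2 * (Λ * Λ * lⱼ) + Λ * Λ * k
          ≤⟨ +-mono-≤ (*-monoʳ-≤ 2 (*-monoˡ-≤ lⱼ (*-mono-≤ Λ≤2k Λ≤2k))) (*-monoˡ-≤ k (*-mono-≤ (Λ≤lam uw) Λ≤2k)) ⟩
        2 * (2 * k * (2 * k) * lⱼ) + lⱼ * (2 * k) * k   ≡⟨ collect lⱼ k ⟩
        10 * T                                          ∎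
        where
        Λ≤2k : Λ ≤ 2 * k
        Λ≤2k = ≤-trans (Λ≤lam uv) (P-half uv)
        T≤ : T ≤ 2 * (ρ′ * (ν * (2 * lⱼ + k)))
        T≤ = *-cancelˡ-≤ ∣ J ∣ {{>-nonZero (∣∣-pos {A = J} (class⁺ refl))}} (begin
          ∣ J ∣ * (lⱼ * (k * k))                          ≡⟨ move₁ (∣ J ∣) lⱼ k ⟩
          lⱼ * (k * (∣ J ∣ * k))                          ≤⟨ *-monoʳ-≤ lⱼ (*-monoʳ-≤ k edges) ⟩
          lⱼ * (k * (ρ′ * d))                             ≡⟨ move₂ lⱼ k ρ′ d ⟩
          ρ′ * (lⱼ * (k * d))                             ≤⟨ *-monoʳ-≤ ρ′ weighted ⟩
          ρ′ * (2 * (∣ J ∣ * (ν * (2 * lⱼ + k))))         ≡⟨ move₃ ρ′ (∣ J ∣) (ν * (2 * lⱼ + k)) ⟩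
          ∣ J ∣ * (2 * (ρ′ * (ν * (2 * lⱼ + k))))         ∎)
          where
          move₁ : ∀ j l k → j * (l * (k * k)) ≡ l * (k * (j * k))
          move₁ = solve-∀
          move₂ : ∀ l k r d → l * (k * (r * d)) ≡ r * (l * (k * d))
          move₂ = solve-∀
          move₃ : ∀ r j a → r * (2 * (j * a)) ≡ j * (2 * (r * a))
          move₃ = solve-∀
        expand : ∀ r ν l k → 16 * (2 * (r * (ν * (2 * l + k)))) ≡ 2 * (32 * (r * ν) * l) + 32 * (r * ν) * k
        expand = solve-∀
        collect : ∀ l k → 2 * (2 * k * (2 * k) * l) + l * (2 * k) * k ≡ 10 * (l * (k * k))
        collect = solve-∀

      10T<16T : 10 * T < 16 * T
      10T<16T = *-monoˡ-< T {{>-nonZero (*-mono-≤ (≤-trans 1≤Λ (Λ≤lam uw)) (*-mono-≤ 1≤k 1≤k))}} (m≤m+n 11 5)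
        where
        1≤k : 1 ≤ k
        1≤k = ∣∣-pos (∈P uv)

    -- The only maximal clique containing u and the part of v at u, because near-of-common makes any
    -- two vertices complete to that part near each other.
    L : Fin n → Fin n → Subset n
    L u v = ⟪ (λ x → near? x u ×-dec all? (λ y → (y ∈? P u v) →-dec near? x y)) ⟫

    L⁻ : ∀ {u v x} → x ∈ L u v → Near x u × Complete x (P u v)
    L⁻ {u} {v} x∈ with ∈⟪⟫⁻ (λ x → near? x u ×-dec all? (λ y → (y ∈? P u v) →-dec near? x y)) x∈
    ... | xu , xP = xu , λ {y} → xP y

    L⁺ : ∀ {u v x} → Near x u → Complete x (P u v) → x ∈ L u v
    L⁺ {u} {v} xu xP = ∈⟪⟫⁺ (λ x → near? x u ×-dec all? (λ y → (y ∈? P u v) →-dec near? x y))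
      (xu , λ y y∈ → xP y∈)

    ∈L₁ : ∀ {u v} → Adj c u v → u ∈ L u v
    ∈L₁ uv = L⁺ (inj₁ refl) (λ y∈ → inj₂ (part-adj uv y∈))

    P⊆L : ∀ {u v} → Adj c u v → P u v ⊆ L u v
    P⊆L uv x∈ = L⁺ (near-sym (inj₂ (part-adj uv x∈))) (P-clique uv x∈)

    ∈L₂ : ∀ {u v} → Adj c u v → v ∈ L u v
    ∈L₂ uv = P⊆L uv (∈P uv)

    L-clique : ∀ {u v} → Adj c u v → Clique (L u v)
    L-clique uv x∈ y∈ = near-of-common (proj₂ (L⁻ x∈)) (proj₂ (L⁻ y∈)) (ν≤P uv)

    L-class : ∀ {u v} → Adj c u v → L u v ∩ class u v ≡ P u v
    L-class {u} {v} uv = ⊆-antisym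
      (λ x∈ → let x∈L , x∈class = x∈p∩q⁻ (L u v) (class u v) x∈ in absorb uv (class⁻ x∈class) (proj₂ (L⁻ x∈L)))
      (λ x∈ → x∈p∩q⁺ (P⊆L uv x∈ , P⊆class uv x∈))

    -- The working form of maximality; for a clique the two agree.
    Saturated : Subset n → Set
    Saturated Q = ∀ {x} → Complete x Q → x ∈ Q

    L-saturated : ∀ {u v} → Adj c u v → Saturated (L u v)
    L-saturated uv xL = L⁺ (xL (∈L₁ uv)) (λ y∈ → xL (P⊆L uv y∈))

    -- Since `a` is outside `P a b`, adding it compensates for the removal of `u`, whichever vertex
    -- `u` is.
    L-large : ∀ {a b u} → Adj c a b → u ∈ L a b → Λ ≤ 2 * ∣ L a b ∩ ∁ ⁅ u ⁆ ∣
    L-large {a} {b} {u} ab u∈ = ≤-trans (Λ≤lam ab) (≤-trans (P-half ab) (*-monoʳ-≤ 2 (≤-pred (begin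
      suc ∣ P a b ∣                 ≡⟨ ∣∣-insert (λ a∈ → proj₁ (part-adj ab a∈) refl) ⟨
      ∣ P a b ∪ ⁅ a ⁆ ∣             ≤⟨ p⊆q⇒∣p∣≤∣q∣ insert-⊆L ⟩
      ∣ L a b ∣                     ≡⟨ ∣∣-remove u∈ ⟩
      suc ∣ L a b ∩ ∁ ⁅ u ⁆ ∣       ∎))))
      where
      open ≤-Reasoning
      insert-⊆L : P a b ∪ ⁅ a ⁆ ⊆ L a b
      insert-⊆L x∈ with x∈p∪q⁻ (P a b) ⁅ a ⁆ x∈
      ... | inj₁ x∈P = P⊆L ab x∈P
      ... | inj₂ x∈a = subst (_∈ L a b) (sym (x∈⁅y⁆⇒x≡y a x∈a)) (∈L₁ ab)

    -- Otherwise Q would meet each of the pairwise disjoint parts at u in fewer than ν vertices.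
    clique-meets-part : ∀ {Q u} → Clique Q → u ∈ Q → Λ ≤ 2 * ∣ Q ∩ ∁ ⁅ u ⁆ ∣ →
      ∃ λ v → Adj c u v × ν ≤ ∣ Q ∩ P u v ∣
    clique-meets-part {Q} {u} cl u∈Q large with any? (λ v → adj? c u v ×-dec (ν ≤? ∣ Q ∩ P u v ∣))
    ... | yes found = found
    ... | no none = contradiction (≤-trans 8ΛΛ≤ ρν-small)
        (<⇒≱ (subst (_< 8 * (Λ * Λ)) (*-identityˡ (Λ * Λ))
          (*-monoˡ-< (Λ * Λ) {{>-nonZero (*-mono-≤ 1≤Λ 1≤Λ)}} {1} {8} (m≤m+n 2 6))))
      where
      open ≤-Reasoning
      Q₀ : Subset n
      Q₀ = Q ∩ ∁ ⁅ u ⁆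
      g : Fin n → ℕ
      g q = ∣ nb u ∩ P u q ∣
      Q₀-adj : ∀ {q} → q ∈ Q₀ → Adj c u q
      Q₀-adj q∈ with ∈-remove⁻ Q q∈
      ... | q∈Q , q≢u = [ (λ u≡q → contradiction (sym u≡q) q≢u) , id ] (cl u∈Q q∈Q)
      few-met : ∀ {v} → v ∈ nb u → ∣ Q₀ ∩ P u v ∣ ≤ ν
      few-met {v} v∈ = ≤-trans
        (p⊆q⇒∣p∣≤∣q∣ λ x∈ → let x∈Q₀ , x∈P = x∈p∩q⁻ Q₀ (P u v) x∈ in x∈p∩q⁺ (proj₁ (∈-remove⁻ Q x∈Q₀) , x∈P))
        (<⇒≤ (≰⇒> λ ν≤ → none (v , nb⁻ v∈ , ν≤)))
      large-part : ∀ {q} → q ∈ Q₀ → Λ ≤ 2 * ∣ nb u ∩ P u q ∣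
      large-part {q} q∈ = ≤-trans (Λ≤lam (Q₀-adj q∈)) (≤-trans (P-half (Q₀-adj q∈))
        (*-monoʳ-≤ 2 (p⊆q⇒∣p∣≤∣q∣ λ x∈ → x∈p∩q⁺ (nb⁺ (part-adj (Q₀-adj q∈) x∈) , x∈))))
      -- Pairs `(q , v)` with `v` in `P u q` are counted: each `q` has at least Λ/2 of them, each
      -- `v` at most `ν`.
      8ΛΛ≤ : 8 * (Λ * Λ) ≤ 32 * (ρ′ * ν)
      8ΛΛ≤ = begin
        8 * (Λ * Λ)                                ≤⟨ *-monoʳ-≤ 8 (*-monoˡ-≤ Λ large) ⟩
        8 * (2 * ∣ Q₀ ∣ * Λ)
          ≡⟨ trans (cong (8 *_) (*-assoc 2 (∣ Q₀ ∣) Λ)) (sym (*-assoc 8 2 (∣ Q₀ ∣ * Λ))) ⟩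
        16 * (∣ Q₀ ∣ * Λ)                          ≡⟨ cong (16 *_) (∑-const Q₀ Λ) ⟨
        16 * ∑ Q₀ (λ _ → Λ)                        ≤⟨ *-monoʳ-≤ 16 (∑-mono Q₀ large-part) ⟩
        16 * ∑ Q₀ (λ q → 2 * ∣ nb u ∩ P u q ∣)
          ≡⟨ trans (cong (16 *_) (∑-*ˡ Q₀ 2 g)) (sym (*-assoc 16 2 (∑ Q₀ g))) ⟩
        32 * ∑ Q₀ (λ q → ∣ nb u ∩ P u q ∣)
          ≤⟨ *-monoʳ-≤ 32 (double-count-≤ Q₀ (nb u) (P u) (P u) (λ q∈ _ v∈ → part-sym (Q₀-adj q∈) v∈)) ⟩
        32 * ∑ (nb u) (λ v → ∣ Q₀ ∩ P u v ∣)       ≤⟨ *-monoʳ-≤ 32 (∑-mono (nb u) few-met) ⟩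
        32 * ∑ (nb u) (λ _ → ν)                    ≡⟨ cong (32 *_) (∑-const (nb u) ν) ⟩
        32 * (∣ nb u ∣ * ν)                        ≤⟨ *-monoʳ-≤ 32 (*-monoˡ-≤ ν (valency u)) ⟩
        32 * (ρ′ * ν)                              ∎

    -- `Q` swallows the part it meets in `ν` vertices, and then, by `matching`, the part of `w`. Two
    -- saturated cliques through `u` that share this part are equal.
    clique≡L : ∀ {Q u w} → Clique Q → Saturated Q → u ∈ Q → Λ ≤ 2 * ∣ Q ∩ ∁ ⁅ u ⁆ ∣ →
      w ∈ Q → Adj c u w → Q ≡ L u w
    clique≡L {Q} {u} {w} cl sat u∈Q large w∈Q uw with clique-meets-part cl u∈Q large
    ... | v , uv , ν≤ = ⊆-antisym
        (λ q∈ → L⁺ (cl q∈ u∈Q) (λ x∈ → cl q∈ (Puw⊆Q x∈)))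
        (λ y∈ → sat λ q∈ → near-of-common (proj₂ (L⁻ y∈)) (λ x∈ → cl q∈ (Puw⊆Q x∈)) (ν≤P uw))
      where
      Puv⊆Q : P u v ⊆ Q
      Puv⊆Q x∈ = sat λ q∈ → near-of-common {A = Q ∩ P u v}
        (λ z∈ → P-clique uv x∈ (proj₂ (x∈p∩q⁻ Q (P u v) z∈)))
        (λ z∈ → cl q∈ (proj₁ (x∈p∩q⁻ Q (P u v) z∈))) ν≤
      -- `w` is complete to `P u v` because both lie in the clique `Q`, so `matching` applies.
      Puw⊆Q : P u w ⊆ Q
      Puw⊆Q x∈ = sat λ q∈ → near-of-common
        (matching uv uw (λ z∈ → cl w∈Q (Puv⊆Q z∈)) x∈) (λ z∈ → cl q∈ (Puv⊆Q z∈)) (ν≤P uv)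

    L≡L : ∀ {a b u v} → Adj c a b → u ∈ L a b → v ∈ L a b → Adj c u v → L a b ≡ L u v
    L≡L ab u∈ v∈ uv = clique≡L (L-clique ab) (L-saturated ab) u∈ (L-large ab u∈) v∈ uv

    -- The clique geometry and its uniformity

    adjPair? : Decidable (λ (p : Fin n × Fin n) → Adj c (proj₁ p) (proj₂ p))
    adjPair? (u , v) = adj? c u v

    adjacentPairs : List (Fin n × Fin n)
    adjacentPairs = filter adjPair? (cartesianProduct (allFin n) (allFin n))

    geometry : List (Subset n)
    geometry = map (λ (u , v) → L u v) adjacentPairs

    geometry⁺ : ∀ {u v} → Adj c u v → L u v ∈ˡ geometry
    geometry⁺ {u} {v} uv = ∈-map⁺ _ (∈-filter⁺ adjPair? (∈-cartesianProduct⁺ (∈-allFin u) (∈-allFin v)) uv)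

    geometry⁻ : ∀ {C} → C ∈ˡ geometry → ∃ λ u → ∃ λ v → Adj c u v × C ≡ L u v
    geometry⁻ C∈ with ∈-map⁻ _ C∈
    ... | (u , v) , p∈ , C≡L =
      u , v , proj₂ (∈-filter⁻ adjPair? {xs = cartesianProduct (allFin n) (allFin n)} p∈) , C≡L

    geometry≡L : ∀ {C u v} → C ∈ˡ geometry → u ∈ C → v ∈ C → Adj c u v → C ≡ L u v
    geometry≡L C∈ u∈ v∈ uv with geometry⁻ C∈
    ... | _ , _ , ab , refl = L≡L ab u∈ v∈ uv

    L-maximal : ∀ {u v} → Adj c u v → IsMaximalClique c (L u v)
    L-maximal uv = (λ x y x∈ y∈ x≢y → [ (λ x≡y → contradiction x≡y x≢y) , id ] (L-clique uv x∈ y∈))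
                 , λ D cl L⊆D {x} x∈D → L-saturated uv λ {y} y∈ → near-in cl x∈D (L⊆D y∈)
      where
      near-in : ∀ {D x y} → IsClique c D → x ∈ D → y ∈ D → Near x y
      near-in {x = x} {y} cl x∈ y∈ with x ≟ᶠ y
      ... | yes x≡y = inj₁ x≡y
      ... | no x≢y = inj₂ (cl x y x∈ y∈ x≢y)

    isCliqueGeometry : IsCliqueGeometry c geometry
    isCliqueGeometry = maximal , λ u v uv →
        (L u v , geometry⁺ uv , ∈L₁ uv , ∈L₂ uv)
      , λ C D C∈ D∈ u∈C v∈C u∈D v∈D → trans (geometry≡L C∈ u∈C v∈C uv) (sym (geometry≡L D∈ u∈D v∈D uv))
      where
      maximal : ∀ C → C ∈ˡ geometry → IsMaximalClique c C
      maximal C C∈ with geometry⁻ C∈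
      ... | _ , _ , uv , refl = L-maximal uv

    -- By `geometry≡L` and `L-class` the intersection is the part of `v` at `u`, whose size is off
    -- by at most `P-err uv`.
    uniform : ∀ M → 3 * (M * (ρ′ * ν)) ≤ Λ * Λ → ∀ {C u v} → C ∈ˡ geometry → u ∈ C → v ∈ C → Adj c u v →
      M * ∣ ∣ C ∩ class u v ∣ - lam c u v ∣ ≤ lam c u v
    uniform M small {C} {u} {v} C∈ u∈ v∈ uv with geometry≡L C∈ u∈ v∈ uv
    ... | refl = ≤-trans (*-monoʳ-≤ M error) (P-err-small uv M small)
      where
      open ≤-Reasoning
      error : ∣ ∣ L u v ∩ class u v ∣ - lam c u v ∣ ≤ P-err uv
      error = begin
        ∣ ∣ L u v ∩ class u v ∣ - lam c u v ∣    ≡⟨ cong (λ S → ∣ ∣ S ∣ - lam c u v ∣) (L-class uv) ⟩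
        ∣ ∣ P u v ∣ - lam c u v ∣                ≤⟨ distance-≤ upper (P-lower uv) ⟩
        P-err uv                                 ∎
        where
        -- The extra one in `P-upper` is covered by `1 ≤ ν ≤ e`.
        upper : ∣ P u v ∣ ≤ lam c u v + P-err uv
        upper = ≤-trans (P-upper uv) (subst (_≤ lam c u v + P-err uv) (+-comm (lam c u v) 1)
          (+-monoʳ-≤ (lam c u v) (≤-trans 1≤ν (P-ν≤e uv))))

-- Intersection numbers of a coherent configuration

module Coherent {n r : ℕ} (c : Coloring n r) (isPCC : IsPCC c) where

  open IsPCC isPCC

  X⁺ : ∀ {j u x} → c u x ≡ j → x ∈ X c j u
  X⁺ {j} {u} = ∈⟪⟫⁺ (λ x → c u x ≟ᶠ j)

  X⁻ : ∀ {j u x} → x ∈ X c j u → c u x ≡ j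
  X⁻ {j} {u} = ∈⟪⟫⁻ (λ x → c u x ≟ᶠ j)

  Xin⁺ : ∀ {j u x} → c x u ≡ j → x ∈ Xin c j u
  Xin⁺ {j} {u} = ∈⟪⟫⁺ (λ x → c x u ≟ᶠ j)

  Xin⁻ : ∀ {j u x} → x ∈ Xin c j u → c x u ≡ j
  Xin⁻ {j} {u} = ∈⟪⟫⁻ (λ x → c x u ≟ᶠ j)

  N⁺ : ∀ {u x} → Adj c u x → x ∈ N c u
  N⁺ {u} = ∈⟪⟫⁺ (adj? c u)

  N⁻ : ∀ {u x} → x ∈ N c u → Adj c u x
  N⁻ {u} = ∈⟪⟫⁻ (adj? c u)

  diag⁺ : ∀ {u v} → u ≡ v → c u v ≡ zero
  diag⁺ {u} {v} = Equivalence.from (diag u v)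

  diag⁻ : ∀ {u v} → c u v ≡ zero → u ≡ v
  diag⁻ {u} {v} = Equivalence.to (diag u v)

  -- The degree is the intersection number at the diagonal pair `(u , u)` for a color and its
  -- converse.
  deg-const : ∀ i u v → deg c i u ≡ deg c i v
  deg-const i u v with converse i
  ... | i* , conv with coherent zero i i*
  ... | p , const = trans (at u) (sym (at v))
    where
    at : ∀ u → deg c i u ≡ p
    at u = trans (cong ∣_∣ (⊆-antisym
        (λ x∈ → x∈p∩q⁺ (x∈ , Xin⁺ (Equivalence.to (conv u _) (X⁻ x∈))))
        (λ x∈ → proj₁ (x∈p∩q⁻ (X c i u) (Xin c i* u) x∈))))
      (const u u (diag⁺ refl))

  -- The pairs of color `i` are counted by their first and by their second vertex; both counts are
  -- `∣ V ∣` times a degree.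
  deg-converse : ∀ {i i*} → (∀ u v → (c u v ≡ i) ⇔ (c v u ≡ i*)) → ∀ w → deg c i* w ≡ deg c i w
  deg-converse {i} {i*} conv w = *-cancelˡ-≡ (deg c i* w) (deg c i w) (∣ V ∣)
    {{>-nonZero (∣∣-pos {A = V} {w} ∈⊤)}} (begin-equality
    ∣ V ∣ * deg c i* w                ≡⟨ total i* ⟩
    ∑ V (λ u → ∣ V ∩ X c i* u ∣)      ≡⟨ double-count V V (X c i*) (X c i)
                                           (λ _ _ x∈ → X⁺ (Equivalence.from (conv _ _) (X⁻ x∈)))
                                           (λ _ _ x∈ → X⁺ (Equivalence.to (conv _ _) (X⁻ x∈))) ⟩
    ∑ V (λ u → ∣ V ∩ X c i u ∣)       ≡⟨ total i ⟨
    ∣ V ∣ * deg c i w                 ∎)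
    where
    open ≤-Reasoning
    V : Subset n
    V = ⊤
    total : ∀ j → ∣ V ∣ * deg c j w ≡ ∑ V (λ u → ∣ V ∩ X c j u ∣)
    total j = trans (sym (∑-const V (deg c j w)))
      (∑-cong V λ {u} _ → trans (deg-const j w u) (cong ∣_∣ (sym (∩-identityˡ (X c j u)))))

  adj-sym : ∀ {u v} → Adj c u v → Adj c v u
  adj-sym {u} {v} (u≢v , _ , small) with converse (c u v)
  ... | i* , conv = u≢v ∘ sym , (λ eq → u≢v (sym (diag⁻ eq))) , λ w →
    subst (λ k → 2 * k < n)
      (trans (sym (deg-converse conv w)) (cong (λ j → deg c j w) (sym (Equivalence.to (conv u v) refl))))
      (small w)

  adj-color : ∀ {u v w} → Adj c u v → c u w ≡ c u v → Adj c u w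
  adj-color (_ , nd) eq =
    (λ u≡w → proj₁ nd (trans (sym eq) (diag⁺ u≡w))) , subst (Nondominant c) (sym eq) nd

  nondominantColors : Subset (suc r)
  nondominantColors = ⟪ nondominant? c ⟫

  nondominant⁺ : ∀ {j} → Nondominant c j → j ∈ nondominantColors
  nondominant⁺ = ∈⟪⟫⁺ (nondominant? c)

  nondominant⇒adj : ∀ {u v} → c u v ∈ nondominantColors → Adj c u v
  nondominant⇒adj nd∈ with ∈⟪⟫⁻ (nondominant? c) nd∈
  ... | nd = (λ u≡v → proj₁ nd (diag⁺ u≡v)) , nd

  -- Sorting the counted vertices `x` by the color of `(x , w)` gives a sum of intersection numbers
  -- over the nondominant colors.
  codegree-coherent : ∀ j {u w u′ w′} → c u w ≡ c u′ w′ → ∣ X c j u ∩ N c w ∣ ≡ ∣ X c j u′ ∩ N c w′ ∣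
  codegree-coherent j {u} {w} {u′} {w′} eq =
    trans (by-color u w) (trans (∑-cong nondominantColors λ {k} _ →
      trans (proj₂ (coherent (c u w) j k) u w refl) (sym (proj₂ (coherent (c u w) j k) u′ w′ (sym eq))))
      (sym (by-color u′ w′)))
    where
    by-color : ∀ u w → ∣ X c j u ∩ N c w ∣ ≡ ∑ nondominantColors (λ k → ∣ X c j u ∩ Xin c k w ∣)
    by-color u w = trans
      (∣∣-fibres (λ x → c x w) (X c j u ∩ N c w) nondominantColors
        (λ x∈ → nondominant⁺ (proj₂ (adj-sym (N⁻ (proj₂ (x∈p∩q⁻ (X c j u) (N c w) x∈)))))))
      (∑-cong nondominantColors λ {k} k∈ → cong ∣_∣ (⊆-antisym
        (λ x∈ → let x∈XN , x∈in = x∈p∩q⁻ (X c j u ∩ N c w) (Xin c k w) x∈ in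
          x∈p∩q⁺ (proj₁ (x∈p∩q⁻ (X c j u) (N c w) x∈XN) , x∈in))
        (λ x∈ → let x∈X , x∈in = x∈p∩q⁻ (X c j u) (Xin c k w) x∈ in
          x∈p∩q⁺ (x∈p∩q⁺ (x∈X ,
            N⁺ (adj-sym (nondominant⇒adj (subst (_∈ nondominantColors) (sym (Xin⁻ x∈in)) k∈)))) , x∈in))))

  common-nbs-coherent : ∀ {u v u′ v′} → c u v ≡ c u′ v′ → ∣ N c u ∩ N c v ∣ ≡ ∣ N c u′ ∩ N c v′ ∣
  common-nbs-coherent {u} {v} {u′} {v′} eq =
    trans (by-color u v) (trans (∑-cong nondominantColors λ {j} _ → codegree-coherent j eq) (sym (by-color u′ v′)))
    where
    by-color : ∀ u v → ∣ N c u ∩ N c v ∣ ≡ ∑ nondominantColors (λ j → ∣ X c j u ∩ N c v ∣)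
    by-color u v = trans
      (∣∣-fibres (c u) (N c u ∩ N c v) nondominantColors
        (λ x∈ → nondominant⁺ (proj₂ (N⁻ (proj₁ (x∈p∩q⁻ (N c u) (N c v) x∈))))))
      (∑-cong nondominantColors λ {j} j∈ → cong ∣_∣ (⊆-antisym
        (λ x∈ → let x∈NN , x∈X = x∈p∩q⁻ (N c u ∩ N c v) (X c j u) x∈ in
          x∈p∩q⁺ (x∈X , proj₂ (x∈p∩q⁻ (N c u) (N c v) x∈NN)))
        (λ x∈ → let x∈X , x∈N = x∈p∩q⁻ (X c j u) (N c v) x∈ in
          x∈p∩q⁺ (x∈p∩q⁺ (N⁺ (nondominant⇒adj (subst (_∈ nondominantColors) (sym (X⁻ x∈X)) j∈)) , x∈N) , x∈X))))

  -- The dominant color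

  module Dominant (4ρ≤n : 4 * suc (ρ c) ≤ n) where

    -- Truncated subtraction errs only upwards, so the inequality survives it.
    n≤n₁+ρ : n ≤ n₁ c + suc (ρ c)
    n≤n₁+ρ = ≤-trans (m≤n+m∸n n (n₁ c)) (+-monoʳ-≤ (n₁ c) (m≤n+m∸n (n ∸ n₁ c) 1))

    3n≤4n₁ : 3 * n ≤ 4 * n₁ c
    3n≤4n₁ = +-cancelʳ-≤ n (3 * n) (4 * n₁ c) (begin
      3 * n + n                        ≡⟨ +-comm (3 * n) n ⟩
      4 * n                            ≤⟨ *-monoʳ-≤ 4 n≤n₁+ρ ⟩
      4 * (n₁ c + suc (ρ c))           ≡⟨ *-distribˡ-+ 4 (n₁ c) _ ⟩
      4 * n₁ c + 4 * suc (ρ c)         ≤⟨ +-monoʳ-≤ (4 * n₁ c) 4ρ≤n ⟩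
      4 * n₁ c + n                     ∎)
      where open ≤-Reasoning

    4≤n : 4 ≤ n
    4≤n = ≤-trans (*-monoʳ-≤ 4 (s≤s z≤n)) 4ρ≤n

    n≤2n₁ : n ≤ 2 * n₁ c
    n≤2n₁ = *-cancelˡ-≤ 2 (begin
      2 * n              ≤⟨ *-monoˡ-≤ n {2} {3} (m≤m+n 2 1) ⟩
      3 * n              ≤⟨ 3n≤4n₁ ⟩
      4 * n₁ c           ≡⟨ *-assoc 2 2 (n₁ c) ⟩
      2 * (2 * n₁ c)     ∎)
      where open ≤-Reasoning

    2≤n₁ : 2 ≤ n₁ c
    2≤n₁ = *-cancelˡ-≤ 2 (≤-trans 4≤n n≤2n₁)

    dominant : ∃ λ d → ∀ u → deg c d u ≡ n₁ c
    dominant = let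
        d , eq = foldr-⊔-attained (λ i → foldr _⊔_ 0 (map (deg c i) (allFin n))) (allFin (suc r)) n₁>0
        v , eq′ = foldr-⊔-attained (deg c d) (allFin n) (subst (0 <_) (sym eq) n₁>0)
      in d , λ u → trans (deg-const d u v) (trans eq′ eq)
      where
      n₁>0 : 0 < n₁ c
      n₁>0 = ≤-trans (s≤s z≤n) 2≤n₁

    d : Fin (suc r)
    d = proj₁ dominant

    deg-d : ∀ u → deg c d u ≡ n₁ c
    deg-d = proj₂ dominant

    d≢0 : ∀ (u : Fin n) → d ≢ zero
    d≢0 u d≡0 = <⇒≱ 2≤n₁ (subst (_≤ 1) (deg-d u) (∣∣≤1 λ x∈ y∈ →
      trans (sym (diag⁻ (trans (X⁻ x∈) d≡0))) (diag⁻ (trans (X⁻ y∈) d≡0))))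

    -- Any color other than `d` has degree at most n - n₁, thus at most n/4, and would make the pair
    -- adjacent.
    nonNear⇒d : ∀ {u v} → ¬ (u ≡ v) → ¬ Adj c u v → c u v ≡ d
    nonNear⇒d {u} {v} u≢v ¬adj = decidable-stable (c u v ≟ᶠ d) λ i≢d →
      ¬adj (u≢v , (λ eq → u≢v (diag⁻ eq)) , λ w → small w i≢d)
      where
      open ≤-Reasoning
      small : ∀ w → c u v ≢ d → 2 * deg c (c u v) w < n
      small w i≢d = *-cancelˡ-< 2 _ _ (+-cancelʳ-< (4 * n₁ c) (2 * (2 * k)) (2 * n) (begin-strict
        2 * (2 * k) + 4 * n₁ c        ≡⟨ expand k (n₁ c) ⟩
        4 * (k + n₁ c)                ≤⟨ *-monoʳ-≤ 4 k+n₁≤n ⟩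
        4 * n                         ≡⟨ *-distribʳ-+ n 1 3 ⟩
        1 * n + 3 * n
          <⟨ +-monoˡ-< (3 * n) (*-monoˡ-< n {{>-nonZero (≤-trans (s≤s z≤n) 4≤n)}} {1} {2} (s≤s (s≤s z≤n))) ⟩
        2 * n + 3 * n                 ≤⟨ +-monoʳ-≤ (2 * n) 3n≤4n₁ ⟩
        2 * n + 4 * n₁ c              ∎))
        where
        k = deg c (c u v) w
        k+n₁≤n : k + n₁ c ≤ n
        k+n₁≤n = begin
          k + n₁ c                                 ≡⟨ cong (k +_) (deg-d w) ⟨
          ∣ X c (c u v) w ∣ + ∣ X c d w ∣
            ≤⟨ ∣∣-disjoint {A = ⊤} (λ _ → ∈⊤) (λ _ → ∈⊤) (λ x∈ x∈′ → i≢d (trans (sym (X⁻ x∈)) (X⁻ x∈′))) ⟩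
          ∣ ⊤ {n} ∣                                ≡⟨ ∣⊤∣≡n n ⟩
          n                                        ∎
        expand : ∀ k m → 2 * (2 * k) + 4 * m ≡ 4 * (k + m)
        expand = solve-∀

    -- `N c u`, the class of `d` at `u` and `u` itself are disjoint; `d` is not nondominant because
    -- `n ≤ 2 * n₁ c`.
    valency : ∀ u → ∣ N c u ∣ ≤ ρ c
    valency u = subst (∣ N c u ∣ ≤_) (sym (∸-+-assoc n (n₁ c) 1)) (m+n≤o⇒m≤o∸n (∣ N c u ∣) (begin
      ∣ N c u ∣ + (n₁ c + 1)                        ≡⟨ cong (∣ N c u ∣ +_) (cong₂ _+_ (deg-d u) (∣⁅x⁆∣≡1 u)) ⟨
      ∣ N c u ∣ + (∣ X c d u ∣ + ∣ ⁅ u ⁆ ∣)         ≤⟨ +-monoʳ-≤ (∣ N c u ∣) (∣∣-disjoint {A = ∁ (N c u)} X⊆ u⊆ X∩u) ⟩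
      ∣ N c u ∣ + ∣ ∁ (N c u) ∣
        ≤⟨ ∣∣-disjoint {A = ⊤} {B = N c u} (λ _ → ∈⊤) (λ _ → ∈⊤) x∈p⇒x∉∁p ⟩
      ∣ ⊤ {n} ∣                                     ≡⟨ ∣⊤∣≡n n ⟩
      n                                             ∎))
      where
      open ≤-Reasoning
      X⊆ : X c d u ⊆ ∁ (N c u)
      X⊆ {x} x∈ = x∉p⇒x∈∁p λ x∈N → <⇒≱
        (subst (λ k → 2 * k < n) (deg-d u)
          (subst (λ j → 2 * deg c j u < n) (X⁻ x∈) (proj₂ (proj₂ (N⁻ x∈N)) u)))
        n≤2n₁
      u⊆ : ⁅ u ⁆ ⊆ ∁ (N c u)
      u⊆ x∈ = x∉p⇒x∈∁p λ x∈N → proj₁ (N⁻ x∈N) (sym (x∈⁅y⁆⇒x≡y u x∈))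
      X∩u : ∀ {x} → x ∈ X c d u → x ∉ ⁅ u ⁆
      X∩u x∈X x∈u = d≢0 u (trans (sym (X⁻ x∈X)) (diag⁺ (sym (x∈⁅y⁆⇒x≡y u x∈u))))

    -- By coherence μ is the same for all `n₁` vertices that the dominant color joins to `u`, and
    -- there are at most ρ² paths of length two from `u` to them.
    common-nbs-bound : ∀ {u v} → ¬ (u ≡ v) → ¬ Adj c u v → ∣ N c u ∩ N c v ∣ * n ≤ 2 * (ρ c * ρ c)
    common-nbs-bound {u} {v} u≢v ¬adj = begin
      μ * n                                       ≤⟨ *-monoʳ-≤ μ n≤2n₁ ⟩
      μ * (2 * n₁ c)                              ≡⟨ rearrange μ (n₁ c) ⟩
      2 * (n₁ c * μ)                              ≡⟨ cong (λ k → 2 * (k * μ)) (deg-d u) ⟨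
      2 * (∣ X c d u ∣ * μ)                       ≡⟨ cong (2 *_) (∑-const (X c d u) μ) ⟨
      2 * ∑ (X c d u) (λ _ → μ)
        ≡⟨ cong (2 *_) (∑-cong (X c d u) λ x∈ → common-nbs-coherent (trans (nonNear⇒d u≢v ¬adj) (sym (X⁻ x∈)))) ⟩
      2 * ∑ (X c d u) (λ x → ∣ N c u ∩ N c x ∣)
        ≤⟨ *-monoʳ-≤ 2 (double-count-≤ (X c d u) (N c u) (N c) (N c) (λ _ _ y∈ → N⁺ (adj-sym (N⁻ y∈)))) ⟩
      2 * ∑ (N c u) (λ y → ∣ X c d u ∩ N c y ∣)
        ≤⟨ *-monoʳ-≤ 2 (∑-mono (N c u) λ {y} _ → ≤-trans (∣p∩q∣≤∣q∣ (X c d u) (N c y)) (valency y)) ⟩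
      2 * ∑ (N c u) (λ _ → ρ c)                   ≡⟨ cong (2 *_) (∑-const (N c u) (ρ c)) ⟩
      2 * (∣ N c u ∣ * ρ c)                       ≤⟨ *-monoʳ-≤ 2 (*-monoˡ-≤ (ρ c) (valency u)) ⟩
      2 * (ρ c * ρ c)                             ∎
      where
      open ≤-Reasoning
      μ : ℕ
      μ = ∣ N c u ∩ N c v ∣
      rearrange : ∀ m k → m * (2 * k) ≡ 2 * (k * m)
      rearrange = solve-∀

-- Numerical estimates

square : ∀ x → x ^ 2 ≡ x * x
square x = cong (x *_) (*-identityʳ x)

cube : ∀ x → x ^ 3 ≡ x * (x * x)
cube x = cong (x *_) (square x)

-- Otherwise n² ≤ n³ ≤ (MR)³, against the hypothesis.
linear-bound : ∀ {M R n} → M ^ 3 * R ^ 3 < n ^ 2 → M * R < n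
linear-bound {M} {R} {n} h = ≰⇒> λ n≤MR → <⇒≱ h (begin
  n ^ 2                       ≤⟨ n²≤n³ n ⟩
  n ^ 3                       ≤⟨ ^-monoˡ-≤ 3 n≤MR ⟩
  (M * R) ^ 3                 ≡⟨ cube (M * R) ⟩
  M * R * (M * R * (M * R))              ≡⟨ distrib M R ⟩
  M * (M * M) * (R * (R * R))            ≡⟨ cong₂ _*_ (cube M) (cube R) ⟨
  M ^ 3 * R ^ 3               ∎)
  where
  open ≤-Reasoning
  distrib : ∀ M R → M * R * (M * R * (M * R)) ≡ M * (M * M) * (R * (R * R))
  distrib = solve-∀
  n²≤n³ : ∀ n → n ^ 2 ≤ n ^ 3
  n²≤n³ zero = z≤n
  n²≤n³ (suc n) = ^-monoʳ-≤ (suc n) {2} {3} (m≤m+n 2 1)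

-- Multiplied by `n`, the left side splits into 2MR³, at most 2n², and MRn, at most n² by
-- `linear-bound`.
ρν-bound : ∀ {M R n ν} → 1 ≤ M → 1 ≤ n → M ^ 3 * R ^ 3 < n ^ 2 → ν * n ≤ 2 * (R * R) + n →
  M * (R * ν) ≤ 3 * n
ρν-bound {M} {R} {n} {ν} 1≤M 1≤n h νn≤ = *-cancelʳ-≤ _ _ n {{>-nonZero 1≤n}} (begin
  M * (R * ν) * n                           ≡⟨ rearrange₁ M R ν n ⟩
  M * (R * (ν * n))                         ≤⟨ *-monoʳ-≤ M (*-monoʳ-≤ R νn≤) ⟩
  M * (R * (2 * (R * R) + n))               ≡⟨ rearrange₂ M R n ⟩
  2 * (M * (R * (R * R))) + M * R * n
    ≤⟨ +-mono-≤ (*-monoʳ-≤ 2 cubic) (*-monoˡ-≤ n (<⇒≤ (linear-bound {M} {R} {n} h))) ⟩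
  2 * (n * n) + n * n                       ≡⟨ collect n ⟩
  3 * n * n                                 ∎)
  where
  open ≤-Reasoning
  instance _ = >-nonZero 1≤M
  cubic : M * (R * (R * R)) ≤ n * n
  cubic = begin
    M * (R * (R * R))        ≡⟨ cong (M *_) (cube R) ⟨
    M * R ^ 3
      ≤⟨ *-monoˡ-≤ (R ^ 3) (≤-trans (m≤m*n M (M * M) {{m*n≢0 M M}}) (≤-reflexive (sym (cube M)))) ⟩
    M ^ 3 * R ^ 3            ≤⟨ <⇒≤ h ⟩
    n ^ 2                    ≡⟨ square n ⟩
    n * n                    ∎
  rearrange₁ : ∀ M R ν n → M * (R * ν) * n ≡ M * (R * (ν * n))
  rearrange₁ = solve-∀
  rearrange₂ : ∀ M R n → M * (R * (2 * (R * R) + n)) ≡ 2 * (M * (R * (R * R))) + M * R * n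
  rearrange₂ = solve-∀
  collect : ∀ n → 2 * (n * n) + n * n ≡ 3 * n * n
  collect = solve-∀

-- The value of m at which the hypothesis on ρ makes q ρ ν ≤ Λ², for ε = 1 / (k + 1).
threshold : ℕ → ℕ → ℕ
threshold k q = 3 * (suc k ^ 2 * q)

-- The bound ρ < n^{2/3} / (m + 1), cubed to stay within natural numbers.
SmallRho : ℕ → PCC → Set
SmallRho m 𝔛 = suc m ^ 3 * ρ (PCC.c 𝔛) ^ 3 < PCC.n 𝔛 ^ 2

-- The geometry of a single configuration

module Construction (k : ℕ) (𝔛 : PCC) (lamBound : LambdaBound k 𝔛) (8≤n : 8 ≤ PCC.n 𝔛)
  (small : SmallRho (threshold k 32) 𝔛) where

  open PCC 𝔛
  open Coherent c isPCC

  a : ℕ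
  a = suc k ^ 2

  1≤a : 1 ≤ a
  1≤a = m^n>0 (suc k) 2

  1≤n : 1 ≤ n
  1≤n = ≤-trans (s≤s z≤n) 8≤n

  -- `linear-bound` yields 8ρ ≤ n, and `8≤n` pays for the successor.
  4ρ≤n : 4 * suc (ρ c) ≤ n
  4ρ≤n = *-cancelˡ-≤ 2 (begin
    2 * (4 * suc (ρ c))                ≡⟨ expand (ρ c) ⟩
    8 + 8 * ρ c
      ≤⟨ +-mono-≤ 8≤n (≤-trans (*-monoˡ-≤ (ρ c) 8≤M) (<⇒≤ (linear-bound {suc (threshold k 32)} {ρ c} {n} small))) ⟩
    n + n                              ≡⟨ cong (n +_) (+-identityʳ n) ⟨
    2 * n                              ∎)
    where
    open ≤-Reasoning
    expand : ∀ x → 2 * (4 * suc x) ≡ 8 + 8 * x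
    expand = solve-∀
    8≤M : 8 ≤ suc (threshold k 32)
    8≤M = begin
      8                       ≤⟨ m≤m+n 8 88 ⟩
      3 * (1 * 32)            ≤⟨ *-monoʳ-≤ 3 (*-monoˡ-≤ 32 1≤a) ⟩
      3 * (a * 32)            ≤⟨ n≤1+n _ ⟩
      suc (threshold k 32)    ∎

  open Dominant 4ρ≤n

  -- ε n^{1/2} rounded up, since ε = 1 / (k + 1).
  least-Λ : ∃ λ Λ → n ≤ a * (Λ * Λ) × (∀ {x} → n ≤ a * (x * x) → Λ ≤ x)
  least-Λ = least (λ x → n ≤? a * (x * x)) n
    (≤-trans (m≤m*n n n {{>-nonZero 1≤n}}) (m≤n*m (n * n) a {{>-nonZero 1≤a}}))

  Λ : ℕ
  Λ = proj₁ least-Λ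

  1≤Λ : 1 ≤ Λ
  1≤Λ = n≢0⇒n>0 λ Λ≡0 → <⇒≱ 1≤n
    (subst (n ≤_) (trans (cong (λ x → a * (x * x)) Λ≡0) (*-zeroʳ a)) (proj₁ (proj₂ least-Λ)))

  Λ≤lam : ∀ {u v} → Adj c u v → Λ ≤ lam c u v
  Λ≤lam {u} {v} (_ , nd) = proj₂ (proj₂ least-Λ)
    (subst (λ y → n ≤ a * y) (square (lam c u v)) (lamBound (c u v) nd u v refl))

  -- `ν` is 2ρ²/n rounded up strictly, hence above the bound on common neighbors and at least one.
  common-bound : ∃ λ ν → 2 * (ρ c * ρ c) < ν * n × ν * n ≤ 2 * (ρ c * ρ c) + n
  common-bound = multiple-above (2 * (ρ c * ρ c)) n 1≤n

  ν : ℕ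
  ν = proj₁ common-bound

  1≤ν : 1 ≤ ν
  1≤ν = n≢0⇒n>0 λ ν≡0 → n≮0 (subst (λ x → 2 * (ρ c * ρ c) < x * n) ν≡0 (proj₁ (proj₂ common-bound)))

  -- The factor `3 * a` inside the threshold cancels the 3 of `ρν-bound` and the `a` in
  -- `n ≤ a * (Λ * Λ)`.
  ρν-small : ∀ q → SmallRho (threshold k q) 𝔛 → q * (ρ c * ν) ≤ Λ * Λ
  ρν-small q small = *-cancelˡ-≤ (3 * a) {{m*n≢0 3 a {{_}} {{>-nonZero 1≤a}}}} (begin
    3 * a * (q * (ρ c * ν))                ≡⟨ rearrange a q (ρ c * ν) ⟩
    threshold k q * (ρ c * ν)              ≤⟨ *-monoˡ-≤ (ρ c * ν) (n≤1+n (threshold k q)) ⟩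
    suc (threshold k q) * (ρ c * ν)
      ≤⟨ ρν-bound {suc (threshold k q)} {ρ c} {n} {ν} (s≤s z≤n) 1≤n small (proj₂ (proj₂ common-bound)) ⟩
    3 * n                                  ≤⟨ *-monoʳ-≤ 3 (proj₁ (proj₂ least-Λ)) ⟩
    3 * (a * (Λ * Λ))                      ≡⟨ *-assoc 3 a (Λ * Λ) ⟨
    3 * a * (Λ * Λ)                        ∎)
    where
    open ≤-Reasoning
    rearrange : ∀ a q x → 3 * a * (q * x) ≡ 3 * (a * q) * x
    rearrange = solve-∀

  open Geometry c adj-sym adj-color (λ j → codegree-coherent j)

  sparse : ∀ x y → ¬ Near x y → ∣ nb x ∩ nb y ∣ < ν
  sparse x y ¬near = *-cancelʳ-< n _ _
    (≤-<-trans (common-nbs-bound (¬near ∘ inj₁) (¬near ∘ inj₂)) (proj₁ (proj₂ common-bound)))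

  open Bounds ν sparse 1≤ν (ρ c) valency Λ 1≤Λ Λ≤lam (ρν-small 32 small) public
    using (geometry; isCliqueGeometry; uniform)

  uniformWithin : ∀ m → SmallRho (threshold k (3 * suc m)) 𝔛 → UniformWithin m 𝔛 geometry
  uniformWithin m small C C∈ u v u∈ v∈ nd = uniform (suc m)
    (subst (_≤ Λ * Λ) (*-assoc 3 (suc m) (ρ c * ν)) (ρν-small (3 * suc m) small)) C∈ u∈ v∈
    ((λ u≡v → proj₁ nd (diag⁺ u≡v)) , nd)

-- The geometries are fixed once, with constant 32. An accuracy `m` only asks for later `t`, where
-- the same parts have relative error at most 1/(m + 1).
theorem2p4 : (k : ℕ) (𝔛 : ℕ → PCC) →
    (∀ N → ∃ λ T → ∀ t → T ≤ t → N ≤ PCC.n (𝔛 t)) →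
    (∀ m → ∃ λ T → ∀ t → T ≤ t →
    (suc m ^ 3) * (ρ (PCC.c (𝔛 t)) ^ 3) < PCC.n (𝔛 t) ^ 2) →
    (∀ t → LambdaBound k (𝔛 t)) →
    Σ ℕ λ T → Σ ((t : ℕ) → T ≤ t → List (Subset (PCC.n (𝔛 t)))) λ 𝒢 →
    (∀ t (p : T ≤ t) → IsCliqueGeometry (PCC.c (𝔛 t)) (𝒢 t p)) ×
    (∀ m → ∃ λ T′ → ∀ t (p : T ≤ t) → T′ ≤ t → UniformWithin m (𝔛 t) (𝒢 t p))
theorem2p4 k 𝔛 n→∞ ρ-small lamBound = T₁ + T₂
  , (λ t p → Construction.geometry k (𝔛 t) (lamBound t) (large t p) (small t p))
  , (λ t p → Construction.isCliqueGeometry k (𝔛 t) (lamBound t) (large t p) (small t p))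
  , λ m → proj₁ (ρ-small (threshold k (3 * suc m))) , λ t p p′ →
      Construction.uniformWithin k (𝔛 t) (lamBound t) (large t p) (small t p) m
        (proj₂ (ρ-small (threshold k (3 * suc m))) t p′)
  where
  T₁ T₂ : ℕ
  T₁ = proj₁ (n→∞ 8)
  T₂ = proj₁ (ρ-small (threshold k 32))
  large : ∀ t → T₁ + T₂ ≤ t → 8 ≤ PCC.n (𝔛 t)
  large t p = proj₂ (n→∞ 8) t (m+n≤o⇒m≤o T₁ p)
  small : ∀ t → T₁ + T₂ ≤ t → SmallRho (threshold k 32) (𝔛 t)
  small t p = proj₂ (ρ-small (threshold k 32)) t (m+n≤o⇒n≤o T₁ p)
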